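{- Let $\Gamma$ be a countable group and let $F\subseteq\Gamma$ be a finite set. Set $G = G(\mathrm{Free}(2^{\Gamma}),F)$. Then $\chi^\ast_{\mathrm{B}}(G)\leq\chi_\beta(G)$.
   Context: All graphs are undirected and simple. A graph $G$ is Borel if $V(G)$ is a standard Borel space and $E(G)$ is a Borel subset of $V(G)\times V(G)$. A set $I \subseteq V(G)$ is $G$-independent if no two vertices in $I$ are adjacent in $G$. For $k \geq 1$, the Borel $k$-fold chromatic number $\chi^k_{\mathrm{B}}(G)$ is the least $\ell \in \mathbb{N}$ such that there are Borel $G$-independent sets $I_1,\ldots,I_\ell$ (not necessarily distinct) that cover every vertex of $G$ at least $k$ times, i.e., every $x \in V(G)$ belongs to $I_i$ for at least $k$ indices $i$ ($\chi^k_{\mathrm{B}}(G) = \infty$ if no such $\ell$ exists). The Borel fractional chromatic number is $\chi^\ast_{\mathrm{B}}(G) = \inf_{k\geq 1} \chi^k_{\mathrm{B}}(G)/k$. For a Borel measure $\mu$ on $V(G)$, the $\mu$-measurable chromatic number $\chi_\mu(G)$ is the least $\ell\in\mathbb{N}$ such that there exist $\mu$-measurable $G$-independent sets $I_1,\ldots,I_\ell$ whose union is $V(G)$. Given a Borel action $\Gamma \curvearrowright X$ of a countable group on a standard Borel space and a finite set $F \subseteq \Gamma$, the Schreier graph $G(X,F)$ has vertex set $X$, with two distinct points $x,y\in X$ adjacent iff $y = \sigma\cdot x$ for some $\sigma \in F\cup F^{ -1}$. The Bernoulli shift $\Gamma \curvearrowright 2^\Gamma$ (where $2=\{0,1\}$)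 is given by $(\gamma\cdot x)(\delta) = x(\delta\gamma)$ for $x\colon\Gamma\to 2$ and $\gamma,\delta\in\Gamma$. $\mathrm{Free}(2^\Gamma)$ is the set of all $x\in 2^\Gamma$ with trivial stabilizer under the shift, with the induced action. $\beta$ is the product probability measure on $2^\Gamma$ of copies of the uniform probability measure on $\{0,1\}$, restricted to $\mathrm{Free}(2^\Gamma)$ where appropriate. -}

module Defs where

open import Algebra.Bundles using (Group)
import Algebra.Properties.Group as GroupProperties
open import Axiom.ExcludedMiddle using (ExcludedMiddle)
open import Data.Bool.Base using (Bool; true)
open import Data.Empty.Polymorphic using (⊥)
open import Data.Fin.Base using (Fin)
open import Data.Fin.Subset using (Subset; ∣_∣) renaming (_∈_ to _∈ˢ_)
open import Data.Integer.Base using (+_)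
open import Data.List.Base using (List; []; _∷_; _++_; map)
import Data.List.Membership.Setoid as SetoidMembership
open import Data.List.Membership.Setoid.Properties
  using (∈-map⁺; ∈-map⁻; ∈-++⁺ˡ; ∈-++⁺ʳ; ∈-++⁻; ∈-resp-≈)
open import Data.List.Relation.Unary.All using (All)
import Data.List.Relation.Unary.Unique.Setoid as SetoidUnique
open import Data.Maybe.Base using (Maybe; maybe′)
open import Data.Nat.Base using (ℕ; zero; suc; NonZero)
import Data.Nat.Base as ℕ
import Data.Nat.Properties as ℕ
open import Data.Product.Base using (Σ; ∃; Σ-syntax; ∃-syntax; _×_; _,_; proj₁; proj₂)
open import Data.Rational.Base using (ℚ; 0ℚ; 1ℚ; ½; _/_)
import Data.Rational.Base as ℚ
import Data.Rational.Properties as ℚ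
open import Data.Sum.Base using (inj₁; inj₂)
open import Function.Bundles using (Func; Injection; _⟨$⟩_)
import Function.Relation.Binary.Setoid.Equality as FuncEquality
open import Level using (Level; 0ℓ; _⊔_) renaming (suc to lsuc)
open import Relation.Binary.Bundles using (Setoid)
open import Relation.Binary.Core using (Rel)
import Relation.Binary.Construct.On as On
open import Relation.Binary.Definitions using (Symmetric; Irreflexive; _Respects_; _Respects₂_)
open import Relation.Binary.PropositionalEquality using (_≡_; refl)
import Relation.Binary.PropositionalEquality as ≡
import Relation.Binary.Reasoning.Setoid as SetoidReasoning
open import Relation.Nullary using (¬_; yes; no; contradiction)
open import Relation.Nullary.Construct.Add.Supremum using (_⁺; [_]; ⊤⁺)
open import Relation.Unary using (Pred; _∈_; _⊆_; _≐_; ∁; _∪_; _∖_; ⋃)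

------------------------------------------------------------------------
-- Extended reals

-- An extended real r is given by the set of rationals strictly above it.
-- In classical logic r ↦ { q ∈ ℚ ∣ r < q } is an order-reversing bijection
-- from [-∞,+∞] onto the rounded upward closed sets of rationals.
record ℝ̄ (p : Level) : Set (lsuc p) where
  field
    above   : Pred ℚ p
    upward  : ∀ {q q′} → q ℚ.< q′ → q ∈ above → q′ ∈ above
    rounded : ∀ {q} → q ∈ above → ∃[ q′ ] q′ ℚ.< q × q′ ∈ above

open ℝ̄ public

private
  variable
    g i p p′ : Level

infix 4 _≤ᴿ_ _≈ᴿ_

_≤ᴿ_ : ℝ̄ p → ℝ̄ p′ → Set (p ⊔ p′)
r ≤ᴿ s = above s ⊆ above r

_≈ᴿ_ : ℝ̄ p → ℝ̄ p′ → Set (p ⊔ p′)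
r ≈ᴿ s = r ≤ᴿ s × s ≤ᴿ r

fromℚ : ℚ → ℝ̄ 0ℓ
fromℚ r = record
  { above   = r ℚ.<_
  ; upward  = λ q<q′ r<q → ℚ.<-trans r<q q<q′
  ; rounded = λ r<q → let (m , r<m , m<q) = ℚ.<-dense r<q in m , m<q , r<m
  }

∞ : ℝ̄ 0ℓ
∞ = record { above = λ _ → ⊥ ; upward = λ _ () ; rounded = λ () }

inf : {I : Set i} → (I → ℝ̄ p) → ℝ̄ (i ⊔ p)
inf x = record
  { above   = λ q → ∃[ j ] q ∈ above (x j)
  ; upward  = λ q<q′ (j , h) → j , upward (x j) q<q′ h
  ; rounded = λ (j , h) → let (m , m<q , h′) = rounded (x j) h in m , m<q , j , h′
  }

sup : {I : Set i} → (I → ℝ̄ p) → ℝ̄ (i ⊔ p)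
sup x = record
  { above   = λ q → ∃[ r ] r ℚ.< q × (∀ j → r ∈ above (x j))
  ; upward  = λ q<q′ (r , r<q , h) → r , ℚ.<-trans r<q q<q′ , h
  ; rounded = λ (r , r<q , h) →
      let (m , r<m , m<q) = ℚ.<-dense r<q in m , m<q , r , r<m , h
  }

partialSum : (ℕ → ℚ) → ℕ → ℚ
partialSum x zero    = 0ℚ
partialSum x (suc n) = partialSum x n ℚ.+ x n

-- Only used for sequences of nonnegative terms.
series : (ℕ → ℚ) → ℝ̄ 0ℓ
series x = sup λ n → fromℚ (partialSum x n)

infixl 7 _÷_
_÷_ : ℕ ⁺ → (k : ℕ) .{{_ : NonZero k}} → ℝ̄ 0ℓ
[ n ] ÷ k = fromℚ (+ n / k)
⊤⁺    ÷ k = ∞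

fromℕ⁺ : ℕ ⁺ → ℝ̄ 0ℓ
fromℕ⁺ n = n ÷ 1

------------------------------------------------------------------------
-- Least elements of sets of natural numbers

IsLeast : Pred ℕ p → ℕ ⁺ → Set p
IsLeast P [ n ] = P n × (∀ m → P m → n ℕ.≤ m)
IsLeast P ⊤⁺    = ∀ n → ¬ P n

module _ (em : ExcludedMiddle p) (P : Pred ℕ p) where

  private
    search : ∀ fuel n → (∀ m → P m → n ℕ.≤ m) → P (fuel ℕ.+ n) → ∃ (IsLeast P)
    search zero       n low h = [ n ] , h , low
    search (suc fuel) n low h with em {P n}
    ... | yes Pn = [ n ] , Pn , low
    ... | no ¬Pn = search fuel (suc n) low′ (≡.subst P (≡.sym (ℕ.+-suc fuel n)) h)
      where
      low′ : ∀ m → P m → suc n ℕ.≤ m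
      low′ m Pm = ℕ.≤∧≢⇒< (low m Pm) λ { refl → ¬Pn Pm }

  leastWithProof : ∃ (IsLeast P)
  leastWithProof with em {∃ P}
  ... | yes (n , Pn) = search n 0 (λ _ _ → ℕ.z≤n) (≡.subst P (≡.sym (ℕ.+-identityʳ n)) Pn)
  ... | no ∄P        = ⊤⁺ , λ n Pn → ∄P (n , Pn)

  least : ℕ ⁺
  least = proj₁ leastWithProof

------------------------------------------------------------------------
-- Graphs and their chromatic numbers

record Graph (g : Level) : Set (lsuc g) where
  field
    vertices      : Setoid g g
  open Setoid vertices public using (_≈_) renaming (Carrier to Vertex)
  field
    Adjacent      : Rel Vertex g
    adjacent-resp : Adjacent Respects₂ _≈_
    symmetric     : Symmetric Adjacent
    irreflexive   : Irreflexive _≈_ Adjacent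

  Independent : Pred (Pred Vertex g) g
  Independent I = ∀ {x y} → x ∈ I → y ∈ I → ¬ Adjacent x y

-- The σ-algebra generated by the sets 𝒮 i.
data σ-algebra {X I : Set g} (𝒮 : I → Pred X 0ℓ) : Pred (Pred X g) (lsuc g) where
  generator  : ∀ i {A} → A ≐ 𝒮 i → σ-algebra 𝒮 A
  complement : ∀ {A} → σ-algebra 𝒮 A → σ-algebra 𝒮 (∁ A)
  union      : ∀ {A : ℕ → Pred X g} → (∀ n → σ-algebra 𝒮 (A n)) → σ-algebra 𝒮 (⋃ ℕ A)
  resp       : ∀ {A B} → A ≐ B → σ-algebra 𝒮 A → σ-algebra 𝒮 B

module Chromatic
  {g : Level} (em : ExcludedMiddle (lsuc g))
  (G : Graph g) (Borel : Pred (Pred (Graph.Vertex G) g) (lsuc g))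
  where

  open Graph G

  HasKFoldCover : ℕ → Pred ℕ (lsuc g)
  HasKFoldCover k ℓ =
    Σ[ I ∈ (Fin ℓ → Pred Vertex g) ]
      (∀ j → Borel (I j)) ×
      (∀ j → Independent (I j)) ×
      (∀ x → Σ[ J ∈ Subset ℓ ] k ℕ.≤ ∣ J ∣ × (∀ {j} → j ∈ˢ J → x ∈ I j))

  kFoldχᴮ : ℕ → ℕ ⁺
  kFoldχᴮ k = least em (HasKFoldCover k)

  fractionalχᴮ : ℝ̄ 0ℓ
  fractionalχᴮ = inf λ k → kFoldχᴮ (suc k) ÷ suc k

  -- A Borel measure enters only through its values on Borel sets; `μ` may be
  -- any extension of it to all sets, such as the induced outer measure.
  module _ (μ : Pred Vertex g → ℝ̄ g) where

    Null : Pred (Pred Vertex g) (lsuc g)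
    Null N = Σ[ M ∈ Pred Vertex g ] Borel M × μ M ≈ᴿ fromℚ 0ℚ × N ⊆ M

    -- Subsets of the vertex setoid are the predicates respecting its
    -- equality; for Borel sets this is automatic as soon as it holds for the
    -- generators of the σ-algebra.
    Measurable : Pred (Pred Vertex g) (lsuc g)
    Measurable A =
      A Respects _≈_ ×
      (Σ[ B ∈ Pred Vertex g ] Borel B × Null ((A ∖ B) ∪ (B ∖ A)))

    HasMeasurableCover : Pred ℕ (lsuc g)
    HasMeasurableCover ℓ =
      Σ[ I ∈ (Fin ℓ → Pred Vertex g) ]
        (∀ j → Measurable (I j)) ×
        (∀ j → Independent (I j)) ×
        (∀ x → ∃[ j ] x ∈ I j)

    measurableχ : ℕ ⁺
    measurableχ = least em HasMeasurableCover

------------------------------------------------------------------------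
-- Group actions, free parts and Schreier graphs

Countable : Setoid g g → Set g
Countable S = Injection S (≡.setoid ℕ)

record Action (Γ : Group g g) (X : Setoid g g) : Set g where
  open Group Γ using (Carrier; _∙_; ε) renaming (_≈_ to _≈ᴳ_)
  open Setoid X using (_≈_) renaming (Carrier to Point)
  infixr 6 _·_
  field
    _·_     : Carrier → Point → Point
    ·-cong  : ∀ {γ δ x y} → γ ≈ᴳ δ → x ≈ y → γ · x ≈ δ · y
    ·-id    : ∀ x → ε · x ≈ x
    ·-assoc : ∀ γ δ x → (γ ∙ δ) · x ≈ γ · δ · x

module _ {Γ : Group g g} {X : Setoid g g} (α : Action Γ X) where

  open Action α
  open Group Γ
    using (Carrier; _∙_; _⁻¹; ε; inverseˡ; inverseʳ; identityʳ; assoc; ∙-cong; ∙-congʳ; ∙-congˡ; ⁻¹-cong)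
    renaming (_≈_ to _≈ᴳ_; refl to reflᴳ; sym to symᴳ; trans to transᴳ; setoid to setoidᴳ)
  open Setoid X using (_≈_; _≉_) renaming (Carrier to Point)
  private
    module X = Setoid X
    module Γₚ = GroupProperties Γ
  open SetoidMembership setoidᴳ using () renaming (_∈_ to _∈ᴸ_)

  private
    ⁻¹-act : ∀ σ {x y} → y ≈ σ · x → x ≈ σ ⁻¹ · y
    ⁻¹-act σ {x} {y} y≈σx = begin
      x              ≈⟨ ·-id x ⟨
      ε · x          ≈⟨ ·-cong (inverseˡ σ) X.refl ⟨
      (σ ⁻¹ ∙ σ) · x ≈⟨ ·-assoc _ _ _ ⟩
      σ ⁻¹ · σ · x   ≈⟨ ·-cong reflᴳ y≈σx ⟨
      σ ⁻¹ · y       ∎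
      where open SetoidReasoning X

    ⁻¹-closed : ∀ F {σ} → σ ∈ᴸ F ++ map _⁻¹ F → σ ⁻¹ ∈ᴸ F ++ map _⁻¹ F
    ⁻¹-closed F σ∈ with ∈-++⁻ setoidᴳ F σ∈
    ... | inj₁ σ∈F = ∈-++⁺ʳ setoidᴳ F (∈-map⁺ setoidᴳ setoidᴳ ⁻¹-cong σ∈F)
    ... | inj₂ σ∈F⁻¹ with ∈-map⁻ setoidᴳ setoidᴳ σ∈F⁻¹
    ...   | τ , τ∈F , σ≈τ⁻¹ = ∈-++⁺ˡ setoidᴳ (∈-resp-≈ setoidᴳ
              (symᴳ (transᴳ (⁻¹-cong σ≈τ⁻¹) (Γₚ.⁻¹-involutive τ))) τ∈F)

  schreier : List Carrier → Graph g
  schreier F = record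
    { vertices      = X
    ; Adjacent      = λ x y → x ≉ y × (∃[ σ ] σ ∈ᴸ F ++ map _⁻¹ F × y ≈ σ · x)
    ; adjacent-resp =
        (λ y≈y′ (x≉y , σ , σ∈ , y≈σx) →
          (λ x≈y′ → x≉y (X.trans x≈y′ (X.sym y≈y′))) ,
          σ , σ∈ , X.trans (X.sym y≈y′) y≈σx) ,
        (λ x≈x′ (x≉y , σ , σ∈ , y≈σx) →
          (λ x′≈y → x≉y (X.trans x≈x′ x′≈y)) ,
          σ , σ∈ , X.trans y≈σx (·-cong reflᴳ x≈x′))
    ; symmetric     = λ (x≉y , σ , σ∈ , y≈σx) →
        (λ y≈x → x≉y (X.sym y≈x)) , σ ⁻¹ , ⁻¹-closed F σ∈ , ⁻¹-act σ y≈σx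
    ; irreflexive   = λ x≈y (x≉y , _) → x≉y x≈y
    }

  IsFree : Pred Point g
  IsFree x = ∀ γ → γ · x ≈ x → γ ≈ᴳ ε

  freePart : Setoid g g
  freePart = On.setoid {B = Σ Point IsFree} X proj₁

  private
    ·-free : ∀ σ {x} → IsFree x → IsFree (σ · x)
    ·-free σ {x} free γ γσx≈σx = Γₚ.∙-cancelʳ σ γ ε (begin
      γ ∙ σ                 ≈⟨ Group.identityˡ Γ _ ⟨
      ε ∙ (γ ∙ σ)           ≈⟨ ∙-congʳ (inverseʳ σ) ⟨
      (σ ∙ σ ⁻¹) ∙ (γ ∙ σ)  ≈⟨ assoc _ _ _ ⟩
      σ ∙ (σ ⁻¹ ∙ (γ ∙ σ))  ≈⟨ ∙-congˡ (free _ fixes) ⟩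
      σ ∙ ε                 ≈⟨ identityʳ σ ⟩
      σ                     ≈⟨ Group.identityˡ Γ σ ⟨
      ε ∙ σ                 ∎)
      where
      open SetoidReasoning setoidᴳ
      fixes : (σ ⁻¹ ∙ (γ ∙ σ)) · x ≈ x
      fixes = X.trans (·-assoc _ _ _)
        (X.sym (⁻¹-act σ (X.trans (·-assoc _ _ _) γσx≈σx)))

  freeAction : Action Γ freePart
  freeAction = record
    { _·_     = λ γ (x , free) → γ · x , ·-free γ free
    ; ·-cong  = ·-cong
    ; ·-id    = λ (x , _) → ·-id x
    ; ·-assoc = λ γ δ (x , _) → ·-assoc γ δ x
    }

------------------------------------------------------------------------
-- The Bernoulli shift

module Bernoulli {g : Level} (Γ : Group g g) where

  open Group Γ using (Carrier; _∙_; setoid; ∙-congʳ; ∙-congˡ; identityʳ; assoc)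
  open SetoidUnique setoid using (Unique)

  2^Γ : Setoid g g
  2^Γ = FuncEquality.setoid setoid (≡.setoid Bool)

  Configuration : Set g
  Configuration = Setoid.Carrier 2^Γ

  shift : Action Γ 2^Γ
  shift = record
    { _·_     = λ γ x → record
        { to   = λ δ → x ⟨$⟩ (δ ∙ γ)
        ; cong = λ δ≈δ′ → Func.cong x (∙-congʳ δ≈δ′)
        }
    ; ·-cong  = λ {γ} {γ′} {x} {y} γ≈γ′ x≈y δ →
        ≡.trans (x≈y (δ ∙ γ)) (Func.cong y (∙-congˡ γ≈γ′))
    ; ·-id    = λ x δ → Func.cong x (identityʳ δ)
    ; ·-assoc = λ γ γ′ x δ → Func.cong x (Group.sym Γ (assoc δ γ γ′))
    }

  Free : Setoid g g
  Free = freePart shift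

  -- The product σ-algebra of 2^Γ (its Borel σ-algebra, Γ being countable),
  -- traced on the free part.
  BorelFree : Pred (Pred (Setoid.Carrier Free) g) (lsuc g)
  BorelFree = σ-algebra λ (γ : Carrier) (x , _) → x ⟨$⟩ γ ≡ true

  -- Distinctness of the coordinates makes `mass` the product measure of the
  -- cylinder.
  record Cylinder : Set g where
    field
      constraints : List (Carrier × Bool)
      distinct    : Unique (map proj₁ constraints)

  ⟦_⟧ : Cylinder → Pred Configuration g
  ⟦ C ⟧ x = All (λ (γ , b) → x ⟨$⟩ γ ≡ b) (Cylinder.constraints C)

  mass : Cylinder → ℚ
  mass C = go (Cylinder.constraints C)
    where
    go : List (Carrier × Bool) → ℚ
    go []       = 1ℚ
    go (_ ∷ cs) = ½ ℚ.* go cs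

  -- `nothing` stands for the empty set. It is needed when Γ is finite, as
  -- nonempty cylinders then have masses bounded away from zero.
  Covers : (ℕ → Maybe Cylinder) → Pred (Pred Configuration g) g
  Covers C A = ∀ {x} → x ∈ A → ∃[ n ] maybe′ (λ c → x ∈ ⟦ c ⟧) ⊥ (C n)

  -- The outer measure obtained from the masses of cylinders by Carathéodory's
  -- construction; on Borel sets it is the product measure.
  β : Pred Configuration g → ℝ̄ g
  β A = inf {I = ∃[ C ] Covers C A} λ (C , _) → series λ n → maybe′ mass 0ℚ (C n)

  -- On a subset of Free, β of the same set viewed as a subset of 2^Γ.
  βFree : Pred (Setoid.Carrier Free) g → ℝ̄ g
  βFree A = β λ x → Σ[ free ∈ IsFree shift x ] (x , free) ∈ A

-- Let I₁, …, Iₙ be measurable independent sets covering the free part.  If Γ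
-- is finite, null sets are empty, so the Iⱼ are Borel already.  If Γ is
-- infinite, the free part is conull; approximating each Iⱼ by a clopen set and
-- removing from it its translates by F ∪ F⁻¹ yields clopen sets C₁, …, Cₙ of
-- configurations such that x and σ · x are never both in Cⱼ, for σ ∈ F ∪ F⁻¹
-- nontrivial, and whose union has measure at least 1 - δ.  Whether z lies in
-- that union depends on z only through a finite window W ⊆ Γ.
--
-- The free part has a Borel coloring c by finitely many colors that is
-- injective on W · x for every x.  For h : colors → 2 let z(h , x) be the
-- configuration γ ↦ h (c (γ · x)).  The sets I(h , j) = {x ∣ z(h , x) ∈ Cⱼ}
-- are Borel and independent because x ↦ z(h , x) is equivariant.  For fixed x
-- the restriction of z(h , x) to W is uniformly distributed over 2^W as h
-- varies, so exactly the fraction measure(⋃ⱼ Cⱼ) of all h have x ∈ ⋃ⱼ I(h , j).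
-- With d colors, this covers every x at least (1 - δ) 2^d times by n 2^d sets.

module Submission where

open import Algebra.Bundles using (Group)
import Algebra.Properties.Group as GroupProperties
open import Axiom.ExcludedMiddle using (ExcludedMiddle)
open import Data.Bool.Base using (Bool; true; false; not; _∧_; _∨_; if_then_else_)
import Data.Bool.Properties as Bool
open import Data.Empty using (⊥-elim)
open import Data.Empty.Polymorphic using () renaming (⊥ to ⊥ₚ)
open import Data.Fin.Base using (Fin; zero; suc; toℕ; fromℕ<; splitAt)
import Data.Fin.Properties as Fin
open import Data.Fin.Subset using (Subset; ∣_∣; ⁅_⁆; ⊥) renaming (_∈_ to _∈ˢ_)
import Data.Fin.Subset.Properties as Subset
open import Data.Integer.Base using (+_)
import Data.Integer.Base as ℤ
import Data.Integer.Properties as ℤ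
open import Data.List.Base using (List; []; _∷_; _++_; map; length)
import Data.List.Base as List
open import Data.List.Membership.Propositional using (find; lose) renaming (_∈_ to _∈ᴾ_)
open import Data.List.Membership.Propositional.Properties using (∈-lookup)
import Data.List.Membership.Setoid as SetoidMembership
import Data.List.Properties as List
open import Data.List.Relation.Unary.All using (All; []; _∷_)
import Data.List.Relation.Unary.All as All
open import Data.List.Relation.Unary.AllPairs using (AllPairs; []; _∷_)
open import Data.List.Relation.Unary.Any using (Any; here; there)
import Data.List.Relation.Unary.Any as Any
open import Data.Maybe.Base using (Maybe; just; nothing; maybe′)
open import Data.Nat.Base using (ℕ; zero; suc; z≤n; s≤s; s≤s⁻¹; NonZero)
import Data.Nat.Base as ℕ
import Data.Nat.DivMod as ℕ
import Data.Nat.Properties as ℕ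
open import Data.Product.Base using (Σ; Σ-syntax; ∃-syntax; _×_; _,_; proj₁; proj₂)
open import Data.Rational.Base using (ℚ; mkℚ; 0ℚ; 1ℚ; ½; _/_)
import Data.Rational.Base as ℚ
import Data.Rational.Properties as ℚ
open import Data.Rational.Solver using (module +-*-Solver)
open import Data.Rational.Unnormalised.Base using (mkℚᵘ)
import Data.Rational.Unnormalised.Base as ℚᵘ
import Data.Rational.Unnormalised.Properties as ℚᵘ
open import Data.Sum.Base using (_⊎_; inj₁; inj₂)
import Data.Sum.Base as Sum
open import Data.Unit.Base using (⊤; tt)
open import Data.Vec.Base using ([]; _∷_)
import Data.Vec.Base as Vec
import Data.Vec.Properties as Vec
open import Function.Base using (_∘_; case_of_)
open import Function.Bundles using (Func; Injection; _⟨$⟩_)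
open import Level using (Level; Lift; lift; lower; 0ℓ) renaming (suc to lsuc)
open import Relation.Binary.Bundles using (Setoid)
open import Relation.Binary.PropositionalEquality
  using (_≡_; _≢_; refl; sym; trans; cong; cong₂; subst; module ≡-Reasoning)
open import Relation.Nullary using (¬_; yes; no; contradiction)
open import Relation.Nullary.Construct.Add.Supremum using ([_]; ⊤⁺)
open import Relation.Nullary.Decidable using (⌊_⌋; map′; decidable-stable)
open import Relation.Unary using (Pred; _∈_; _⊆_; _≐_; ∁; _∪_; _∩_; ⋃)
open import Defs

-- Points of `2^Γ` are handled as bit sequences through an injection of Γ into ℕ. An index that
-- codes no group element stays as a dummy coordinate fixed by all translations, so one coin measure
-- serves every Γ. General sets of sequences get no measure of their own; they are only shown to be
-- `Small`, that is, to lie in open sets of small measure. Compactness turns such a cover back into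
-- a bound on the measure of a clopen set. The obstacle is that a clopen approximation of an
-- independent set need not be independent, while z(h , x) may be any configuration, even a constant
-- one, so a property valid almost everywhere would say nothing about it. Deleting translates forces
-- independence at every sequence. The deletion is cheap: if y lies in the independent set A and in
-- its approximation C, and σ · y lies in C too, then σ · y is not in A, hence is already an error
-- of the approximation. So only errors and their translates are lost, and translations preserve the
-- measure.

private
  variable
    ℓ ℓ′ ℓ″ : Level

-- The fair coin measure on 2^ℕ

Sequence : Set
Sequence = ℕ → Bool

infixr 5 _◂_
_◂_ : Bool → Sequence → Sequence
(b ◂ y) zero    = b
(b ◂ y) (suc i) = y i

update : ℕ → Bool → Sequence → Sequence
update zero    b y = b ◂ y ∘ suc
update (suc a) b y = y 0 ◂ update a b (y ∘ suc)

update-same : ∀ a b y → update a b y a ≡ b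
update-same zero    b y = refl
update-same (suc a) b y = update-same a b (y ∘ suc)

update-other : ∀ {a i} b y → i ≢ a → update a b y i ≡ y i
update-other {zero}  {zero}  b y i≢a = contradiction refl i≢a
update-other {zero}  {suc i} b y i≢a = refl
update-other {suc a} {zero}  b y i≢a = refl
update-other {suc a} {suc i} b y i≢a = update-other b (y ∘ suc) (i≢a ∘ cong suc)

Local : ℕ → (Sequence → Bool) → Set
Local n φ = ∀ y y′ → (∀ i → i ℕ.< n → y i ≡ y′ i) → φ y ≡ φ y′

Extensional : (Sequence → Bool) → Set
Extensional φ = ∀ y y′ → (∀ i → y i ≡ y′ i) → φ y ≡ φ y′

local⇒extensional : ∀ {n φ} → Local n φ → Extensional φ
local⇒extensional loc y y′ eq = loc y y′ λ i _ → eq i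

◂-cong : ∀ b {y y′} → (∀ i → y i ≡ y′ i) → ∀ i → (b ◂ y) i ≡ (b ◂ y′) i
◂-cong b eq zero    = refl
◂-cong b eq (suc i) = eq i

◂-η : ∀ y i → y i ≡ (y 0 ◂ y ∘ suc) i
◂-η y zero    = refl
◂-η y (suc i) = refl

extensional-◂ : ∀ {φ} b → Extensional φ → Extensional (φ ∘ (b ◂_))
extensional-◂ b ext y y′ eq = ext _ _ (◂-cong b eq)

local-◂ : ∀ {n φ} b → Local (suc n) φ → Local n (φ ∘ (b ◂_))
local-◂ b loc y y′ eq = loc _ _ λ { zero _ → refl ; (suc i) i<n → eq i (s≤s⁻¹ i<n) }

local-≤ : ∀ {m n φ} → m ℕ.≤ n → Local m φ → Local n φ
local-≤ m≤n loc y y′ eq = loc y y′ λ i i<m → eq i (ℕ.<-≤-trans i<m m≤n)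

indicator : Bool → ℚ
indicator false = 0ℚ
indicator true  = 1ℚ

-- Opaque, as unification would otherwise try to invert multiplication by ½.
opaque
  avg : ℚ → ℚ → ℚ
  avg p q = ½ ℚ.* (p ℚ.+ q)

  avg-same : ∀ p → avg p p ≡ p
  avg-same = solve 1 (λ p → con ½ :* (p :+ p) := p) refl
    where open +-*-Solver

  avg-zeroˡ : ∀ p → avg 0ℚ p ≡ ½ ℚ.* p
  avg-zeroˡ p = cong (½ ℚ.*_) (ℚ.+-identityˡ p)

  avg-zeroʳ : ∀ p → avg p 0ℚ ≡ ½ ℚ.* p
  avg-zeroʳ p = cong (½ ℚ.*_) (ℚ.+-identityʳ p)

  avg-mono : ∀ {p p′ q q′} → p ℚ.≤ p′ → q ℚ.≤ q′ → avg p q ℚ.≤ avg p′ q′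
  avg-mono p≤p′ q≤q′ = ℚ.*-monoˡ-≤-nonNeg ½ (ℚ.+-mono-≤ p≤p′ q≤q′)

  avg-+ : ∀ p q r s → avg p q ℚ.+ avg r s ≡ avg (p ℚ.+ r) (q ℚ.+ s)
  avg-+ = solve 4 (λ p q r s →
      con ½ :* (p :+ q) :+ con ½ :* (r :+ s) := con ½ :* ((p :+ r) :+ (q :+ s))) refl
    where open +-*-Solver

  avg-*ʳ : ∀ p q r → avg p q ℚ.* r ≡ ½ ℚ.* (p ℚ.* r ℚ.+ q ℚ.* r)
  avg-*ʳ = solve 3 (λ p q r → (con ½ :* (p :+ q)) :* r := con ½ :* (p :* r :+ q :* r)) refl
    where open +-*-Solver

  avg-interchange : ∀ p q r s → avg (avg p q) (avg r s) ≡ avg (avg p r) (avg q s)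
  avg-interchange = solve 4 (λ p q r s →
      con ½ :* (con ½ :* (p :+ q) :+ con ½ :* (r :+ s)) :=
      con ½ :* (con ½ :* (p :+ r) :+ con ½ :* (q :+ s))) refl
    where open +-*-Solver

-- The fraction of the words of length `n` at which `φ` holds, all later bits being set to `false`.
-- It is the coin measure of `φ` once `φ` is `Local n`.
μ : ℕ → (Sequence → Bool) → ℚ
μ zero    φ = indicator (φ λ _ → false)
μ (suc n) φ = avg (μ n (φ ∘ (false ◂_))) (μ n (φ ∘ (true ◂_)))

μ-cong : ∀ n {φ ψ} → (∀ y → φ y ≡ ψ y) → μ n φ ≡ μ n ψ
μ-cong zero    eq = cong indicator (eq _)
μ-cong (suc n) eq = cong₂ avg (μ-cong n (eq ∘ (false ◂_))) (μ-cong n (eq ∘ (true ◂_)))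

μ-const : ∀ n b → μ n (λ _ → b) ≡ indicator b
μ-const zero    b = refl
μ-const (suc n) b = trans (cong₂ avg (μ-const n b) (μ-const n b)) (avg-same _)

-- Two terms on each side let one induction serve for monotonicity, subadditivity, differences and
-- complements; `∅ᶜ` fills the vacant places.
μ-mono₂ : ∀ n {φ ψ χ ω} →
  (∀ y → indicator (φ y) ℚ.+ indicator (ψ y) ℚ.≤ indicator (χ y) ℚ.+ indicator (ω y)) →
  μ n φ ℚ.+ μ n ψ ℚ.≤ μ n χ ℚ.+ μ n ω
μ-mono₂ zero le = le _
μ-mono₂ (suc n) {φ} {ψ} {χ} {ω} le = begin
  μ (suc n) φ ℚ.+ μ (suc n) ψ                        ≡⟨ avg-+ (μ₀ φ) (μ₁ φ) (μ₀ ψ) (μ₁ ψ) ⟩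
  avg (μ₀ φ ℚ.+ μ₀ ψ) (μ₁ φ ℚ.+ μ₁ ψ)
    ≤⟨ avg-mono (μ-mono₂ n (le ∘ (false ◂_))) (μ-mono₂ n (le ∘ (true ◂_))) ⟩
  avg (μ₀ χ ℚ.+ μ₀ ω) (μ₁ χ ℚ.+ μ₁ ω)               ≡⟨ avg-+ (μ₀ χ) (μ₁ χ) (μ₀ ω) (μ₁ ω) ⟨
  μ (suc n) χ ℚ.+ μ (suc n) ω                        ∎
  where
  open ℚ.≤-Reasoning
  μ₀ μ₁ : (Sequence → Bool) → ℚ
  μ₀ φ = μ n (φ ∘ (false ◂_))
  μ₁ φ = μ n (φ ∘ (true ◂_))

μ-local : ∀ {m n φ} → Local m φ → m ℕ.≤ n → μ n φ ≡ μ m φ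
μ-local {zero}  {n}     loc z≤n       = trans (μ-cong n λ y → loc y _ λ _ ()) (μ-const n _)
μ-local {suc m} {suc n} loc (s≤s m≤n) =
  cong₂ avg (μ-local (local-◂ false loc) m≤n) (μ-local (local-◂ true loc) m≤n)

-- Averages over different bits commute, so the average over bit `a` can be moved to the front.
μ-update : ∀ {n a φ} → Extensional φ → a ℕ.< n →
  μ n φ ≡ avg (μ n (φ ∘ update a false)) (μ n (φ ∘ update a true))
μ-update {suc n} {zero} {φ} ext _ = cong₂ avg (sym (avg-same _)) (sym (avg-same _))
μ-update {suc n} {suc a} {φ} ext (s≤s a<n) = trans
  (cong₂ avg (μ-update (extensional-◂ false ext) a<n) (μ-update (extensional-◂ true ext) a<n))
  (avg-interchange _ _ _ _)

-- Averaging first over the bit with index κ 0 reduces the claim to κ ∘ suc.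
μ-reindex : ∀ {m n φ} (κ : ℕ → ℕ) → Local m φ →
  (∀ {i} → i ℕ.< m → κ i ℕ.< n) →
  (∀ {i j} → i ℕ.< m → j ℕ.< m → κ i ≡ κ j → i ≡ j) →
  μ n (λ y → φ (y ∘ κ)) ≡ μ m φ
μ-reindex {zero} {n} {φ} κ loc _ _ =
  trans (μ-cong n λ y → loc (y ∘ κ) _ λ _ ()) (μ-const n _)
μ-reindex {suc m} {n} {φ} κ loc κ< κ-inj =
  trans (μ-update ext (κ< (s≤s z≤n))) (cong₂ avg (tail false) (tail true))
  where
  ext : Extensional (λ y → φ (y ∘ κ))
  ext y y′ eq = loc _ _ λ i _ → eq (κ i)

  tail : ∀ b → μ n (λ y → φ (update (κ 0) b y ∘ κ)) ≡ μ m (φ ∘ (b ◂_))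
  tail b = trans
    (μ-cong n λ y → loc (update (κ 0) b y ∘ κ) (b ◂ y ∘ κ ∘ suc) λ
      { zero _ → update-same (κ 0) b y
      ; (suc i) i<m → update-other b y λ eq → case κ-inj i<m (s≤s z≤n) eq of λ () })
    (μ-reindex (κ ∘ suc) (local-◂ b loc) (κ< ∘ s≤s)
      λ i<m j<m eq → ℕ.suc-injective (κ-inj (s≤s i<m) (s≤s j<m) eq))

-- Clopen subsets of 2^ℕ and their measure

record Clopen : Set where
  field
    contains : Sequence → Bool
    size     : ℕ
    local    : Local size contains

open Clopen

infix 4 _∈ᶜ_ _⊆ᶜ_
_∈ᶜ_ : Sequence → Clopen → Set
y ∈ᶜ C = contains C y ≡ true

_⊆ᶜ_ : Clopen → Clopen → Set
C ⊆ᶜ D = ∀ {y} → y ∈ᶜ C → y ∈ᶜ D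

∈ᶜ-resp : ∀ C {y y′} → (∀ i → y i ≡ y′ i) → y ∈ᶜ C → y′ ∈ᶜ C
∈ᶜ-resp C eq y∈C = trans (local C _ _ λ i _ → sym (eq i)) y∈C

∈ᶜ? : ∀ C y → y ∈ᶜ C ⊎ contains C y ≡ false
∈ᶜ? C y with contains C y
... | true  = inj₁ refl
... | false = inj₂ refl

measure : Clopen → ℚ
measure C = μ (size C) (contains C)

measure-μ : ∀ C {n} → size C ℕ.≤ n → measure C ≡ μ n (contains C)
measure-μ C size≤n = sym (μ-local (local C) size≤n)

∅ᶜ fullᶜ : Clopen
∅ᶜ    = record { contains = λ _ → false ; size = 0 ; local = λ _ _ _ → refl }
fullᶜ = record { contains = λ _ → true ; size = 0 ; local = λ _ _ _ → refl }

∁ᶜ : Clopen → Clopen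
∁ᶜ C = record
  { contains = not ∘ contains C
  ; size     = size C
  ; local    = λ y y′ eq → cong not (local C y y′ eq)
  }

infixr 7 _∩ᶜ_ _∖ᶜ_
infixr 6 _∪ᶜ_

_∪ᶜ_ _∩ᶜ_ _∖ᶜ_ : Clopen → Clopen → Clopen
C ∪ᶜ D = record
  { contains = λ y → contains C y ∨ contains D y
  ; size     = size C ℕ.+ size D
  ; local    = λ y y′ eq → cong₂ _∨_
      (local-≤ (ℕ.m≤m+n _ _) (local C) y y′ eq) (local-≤ (ℕ.m≤n+m _ (size C)) (local D) y y′ eq)
  }
C ∩ᶜ D = record
  { contains = λ y → contains C y ∧ contains D y
  ; size     = size C ℕ.+ size D
  ; local    = λ y y′ eq → cong₂ _∧_
      (local-≤ (ℕ.m≤m+n _ _) (local C) y y′ eq) (local-≤ (ℕ.m≤n+m _ (size C)) (local D) y y′ eq)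
  }
C ∖ᶜ D = C ∩ᶜ ∁ᶜ D

⋃ᶜ : (ℕ → Clopen) → ℕ → Clopen
⋃ᶜ C zero    = ∅ᶜ
⋃ᶜ C (suc n) = ⋃ᶜ C n ∪ᶜ C n

∈-∪ᶜ⁺ˡ : ∀ C D {y} → y ∈ᶜ C → y ∈ᶜ C ∪ᶜ D
∈-∪ᶜ⁺ˡ C D y∈C rewrite y∈C = refl

∈-∪ᶜ⁺ʳ : ∀ C D {y} → y ∈ᶜ D → y ∈ᶜ C ∪ᶜ D
∈-∪ᶜ⁺ʳ C D y∈D rewrite y∈D = Bool.∨-zeroʳ _

∈-∪ᶜ⁻ : ∀ C D {y} → y ∈ᶜ C ∪ᶜ D → y ∈ᶜ C ⊎ y ∈ᶜ D
∈-∪ᶜ⁻ C D {y} y∈ with contains C y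
... | true  = inj₁ refl
... | false = inj₂ y∈

∈-∩ᶜ⁺ : ∀ C D {y} → y ∈ᶜ C → y ∈ᶜ D → y ∈ᶜ C ∩ᶜ D
∈-∩ᶜ⁺ C D y∈C y∈D rewrite y∈C = y∈D

∈-∩ᶜ⁻ : ∀ C D {y} → y ∈ᶜ C ∩ᶜ D → y ∈ᶜ C × y ∈ᶜ D
∈-∩ᶜ⁻ C D {y} y∈ with contains C y
... | true = refl , y∈

∈-∁ᶜ⁺ : ∀ C {y} → ¬ y ∈ᶜ C → y ∈ᶜ ∁ᶜ C
∈-∁ᶜ⁺ C {y} y∉ with contains C y
... | true  = contradiction refl y∉
... | false = refl

∈-∁ᶜ⁻ : ∀ C {y} → y ∈ᶜ ∁ᶜ C → ¬ y ∈ᶜ C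
∈-∁ᶜ⁻ C y∈ y∈C rewrite y∈C = case y∈ of λ ()

∈-⋃ᶜ⁺ : ∀ C {i n y} → i ℕ.< n → y ∈ᶜ C i → y ∈ᶜ ⋃ᶜ C n
∈-⋃ᶜ⁺ C {i} {suc n} i<1+n y∈ with ℕ.m≤n⇒m<n∨m≡n (s≤s⁻¹ i<1+n)
... | inj₁ i<n  = ∈-∪ᶜ⁺ˡ (⋃ᶜ C n) (C n) (∈-⋃ᶜ⁺ C i<n y∈)
... | inj₂ refl = ∈-∪ᶜ⁺ʳ (⋃ᶜ C n) (C n) y∈

∈-⋃ᶜ⁻ : ∀ C n {y} → y ∈ᶜ ⋃ᶜ C n → ∃[ i ] i ℕ.< n × y ∈ᶜ C i
∈-⋃ᶜ⁻ C (suc n) y∈ with ∈-∪ᶜ⁻ (⋃ᶜ C n) (C n) y∈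
... | inj₂ y∈Cₙ = n , ℕ.n<1+n n , y∈Cₙ
... | inj₁ y∈⋃ with ∈-⋃ᶜ⁻ C n y∈⋃
...   | i , i<n , y∈Cᵢ = i , ℕ.m<n⇒m<1+n i<n , y∈Cᵢ

measure-mono₂ : ∀ A B C D →
  (∀ y → indicator (contains A y) ℚ.+ indicator (contains B y)
           ℚ.≤ indicator (contains C y) ℚ.+ indicator (contains D y)) →
  measure A ℚ.+ measure B ℚ.≤ measure C ℚ.+ measure D
measure-mono₂ A B C D le = begin
  measure A ℚ.+ measure B                 ≡⟨ cong₂ ℚ._+_ (measure-μ A a) (measure-μ B b) ⟩
  μ n (contains A) ℚ.+ μ n (contains B)   ≤⟨ μ-mono₂ n le ⟩
  μ n (contains C) ℚ.+ μ n (contains D)   ≡⟨ cong₂ ℚ._+_ (measure-μ C c) (measure-μ D d) ⟨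
  measure C ℚ.+ measure D                 ∎
  where
  open ℚ.≤-Reasoning
  n = (size A ℕ.+ size B) ℕ.+ (size C ℕ.+ size D)
  a : size A ℕ.≤ n
  a = ℕ.m≤n⇒m≤n+o _ (ℕ.m≤m+n (size A) (size B))
  b : size B ℕ.≤ n
  b = ℕ.m≤n⇒m≤n+o _ (ℕ.m≤n+m (size B) (size A))
  c : size C ℕ.≤ n
  c = ℕ.m≤n⇒m≤o+n (size A ℕ.+ size B) (ℕ.m≤m+n _ _)
  d : size D ℕ.≤ n
  d = ℕ.m≤n⇒m≤o+n (size A ℕ.+ size B) (ℕ.m≤n+m _ _)

0≤1ℚ : 0ℚ ℚ.≤ 1ℚ
0≤1ℚ = ℚ.nonNegative⁻¹ 1ℚ

indicator-nonNeg : ∀ b → 0ℚ ℚ.≤ indicator b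
indicator-nonNeg false = ℚ.≤-refl
indicator-nonNeg true  = 0≤1ℚ

measure-mono : ∀ C D → C ⊆ᶜ D → measure C ℚ.≤ measure D
measure-mono C D C⊆D = begin
  measure C            ≡⟨ ℚ.+-identityʳ _ ⟨
  measure C ℚ.+ 0ℚ     ≤⟨ measure-mono₂ C ∅ᶜ D ∅ᶜ pointwise ⟩
  measure D ℚ.+ 0ℚ     ≡⟨ ℚ.+-identityʳ _ ⟩
  measure D            ∎
  where
  open ℚ.≤-Reasoning
  pointwise : ∀ y → indicator (contains C y) ℚ.+ 0ℚ ℚ.≤ indicator (contains D y) ℚ.+ 0ℚ
  pointwise y with contains C y in eq
  ... | true rewrite C⊆D eq = ℚ.≤-refl
  ... | false = ℚ.+-monoˡ-≤ 0ℚ (indicator-nonNeg (contains D y))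

measure-∪ : ∀ C D → measure (C ∪ᶜ D) ℚ.≤ measure C ℚ.+ measure D
measure-∪ C D = begin
  measure (C ∪ᶜ D)          ≡⟨ ℚ.+-identityʳ _ ⟨
  measure (C ∪ᶜ D) ℚ.+ 0ℚ   ≤⟨ measure-mono₂ (C ∪ᶜ D) ∅ᶜ C D pointwise ⟩
  measure C ℚ.+ measure D   ∎
  where
  open ℚ.≤-Reasoning
  pointwise : ∀ y → indicator (contains C y ∨ contains D y) ℚ.+ 0ℚ
                      ℚ.≤ indicator (contains C y) ℚ.+ indicator (contains D y)
  pointwise y with contains C y | contains D y
  ... | false | false = ℚ.≤-refl
  ... | false | true  = ℚ.≤-refl
  ... | true  | d     = ℚ.+-monoʳ-≤ 1ℚ (indicator-nonNeg d)

measure-∖ : ∀ C D → D ⊆ᶜ C → measure (C ∖ᶜ D) ℚ.+ measure D ℚ.≤ measure C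
measure-∖ C D D⊆C = begin
  measure (C ∖ᶜ D) ℚ.+ measure D   ≤⟨ measure-mono₂ (C ∖ᶜ D) D C ∅ᶜ pointwise ⟩
  measure C ℚ.+ 0ℚ                 ≡⟨ ℚ.+-identityʳ _ ⟩
  measure C                        ∎
  where
  open ℚ.≤-Reasoning
  pointwise : ∀ y → indicator (contains C y ∧ not (contains D y)) ℚ.+ indicator (contains D y)
                      ℚ.≤ indicator (contains C y) ℚ.+ 0ℚ
  pointwise y with contains D y in eq
  ... | true rewrite D⊆C eq = ℚ.≤-refl
  ... | false rewrite Bool.∧-identityʳ (contains C y) = ℚ.≤-refl

measure-∁ : ∀ C → 1ℚ ℚ.≤ measure C ℚ.+ measure (∁ᶜ C)
measure-∁ C = begin
  1ℚ                              ≡⟨ ℚ.+-identityʳ _ ⟨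
  1ℚ ℚ.+ 0ℚ                       ≤⟨ measure-mono₂ fullᶜ ∅ᶜ C (∁ᶜ C) pointwise ⟩
  measure C ℚ.+ measure (∁ᶜ C)    ∎
  where
  open ℚ.≤-Reasoning
  pointwise : ∀ y → 1ℚ ℚ.+ 0ℚ ℚ.≤ indicator (contains C y) ℚ.+ indicator (not (contains C y))
  pointwise y with contains C y
  ... | true  = ℚ.≤-refl
  ... | false = ℚ.≤-refl

measure-nonNeg : ∀ C → 0ℚ ℚ.≤ measure C
measure-nonNeg C = measure-mono ∅ᶜ C λ ()

measure-≤1 : ∀ C → measure C ℚ.≤ 1ℚ
measure-≤1 C = measure-mono C fullᶜ λ _ → refl

bit : ℕ → Bool → Clopen
bit a b = record
  { contains = λ y → ⌊ y a Bool.≟ b ⌋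
  ; size     = suc a
  ; local    = λ y y′ eq → cong (λ c → ⌊ c Bool.≟ b ⌋) (eq a (ℕ.n<1+n a))
  }

∈-bit⁺ : ∀ a b y → y a ≡ b → y ∈ᶜ bit a b
∈-bit⁺ a b y eq with y a Bool.≟ b
... | yes _   = refl
... | no y≢b  = contradiction eq y≢b

∈-bit⁻ : ∀ a b y → y ∈ᶜ bit a b → y a ≡ b
∈-bit⁻ a b y y∈ with y a Bool.≟ b
... | yes eq = eq

-- In the average over bit `a`, one value contributes nothing and the other contributes all of `C`.
measure-bit-∩ : ∀ a b C → (∀ c y → contains C (update a c y) ≡ contains C y) →
  measure (bit a b ∩ᶜ C) ≡ ½ ℚ.* measure C
measure-bit-∩ a b C inv = trans
  (μ-update (local⇒extensional (local (bit a b ∩ᶜ C))) (s≤s (ℕ.m≤m+n a _)))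
  (trans (split b) (cong (½ ℚ.*_) (sym (measure-μ C (ℕ.m≤n+m (size C) (suc a))))))
  where
  n = suc a ℕ.+ size C

  fixed : ∀ b c → μ n (λ y → contains (bit a b ∩ᶜ C) (update a c y))
                    ≡ μ n (λ y → ⌊ c Bool.≟ b ⌋ ∧ contains C y)
  fixed b c = μ-cong n λ y → cong₂ (λ d → ⌊ d Bool.≟ b ⌋ ∧_) (update-same a c y) (inv c y)

  split : ∀ b → avg (μ n (contains (bit a b ∩ᶜ C) ∘ update a false))
                    (μ n (contains (bit a b ∩ᶜ C) ∘ update a true)) ≡ ½ ℚ.* μ n (contains C)
  split false = trans (cong₂ avg (fixed false false) (trans (fixed false true) (μ-const n false)))
    (avg-zeroʳ _)
  split true  = trans (cong₂ avg (trans (fixed true false) (μ-const n false)) (fixed true true))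
    (avg-zeroˡ _)

boundBelow : (κ : ℕ → ℕ) → ∀ m → ∃[ n ] (∀ {i} → i ℕ.< m → κ i ℕ.< n)
boundBelow κ zero = 0 , λ ()
boundBelow κ (suc m) with boundBelow κ m
... | n , κ< = n ℕ.+ suc (κ m) , λ {i} i<1+m → case ℕ.m≤n⇒m<n∨m≡n (s≤s⁻¹ i<1+m) of λ
      { (inj₁ i<m) → ℕ.m≤n⇒m≤n+o _ (κ< i<m)
      ; (inj₂ refl) → ℕ.m≤n+m _ n }

preimage : (ℕ → ℕ) → Clopen → Clopen
preimage κ C = record
  { contains = λ y → contains C (y ∘ κ)
  ; size     = proj₁ (boundBelow κ (size C))
  ; local    = λ y y′ eq → local C _ _ λ i i<m → eq (κ i) (proj₂ (boundBelow κ (size C)) i<m)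
  }

measure-preimage : ∀ {κ} C → (∀ {i j} → κ i ≡ κ j → i ≡ j) →
  measure (preimage κ C) ≡ measure C
measure-preimage {κ} C κ-inj =
  μ-reindex κ (local C) (proj₂ (boundBelow κ (size C))) λ _ _ → κ-inj

-- Arithmetic of rationals

fromℚᵘ-homo-* : ∀ p q → ℚ.fromℚᵘ p ℚ.* ℚ.fromℚᵘ q ≡ ℚ.fromℚᵘ (p ℚᵘ.* q)
fromℚᵘ-homo-* p q = ℚ.toℚᵘ-injective (ℚᵘ.≃-trans (ℚ.toℚᵘ-homo-* (ℚ.fromℚᵘ p) (ℚ.fromℚᵘ q))
  (ℚᵘ.≃-trans (ℚᵘ.*-cong (ℚ.toℚᵘ-fromℚᵘ p) (ℚ.toℚᵘ-fromℚᵘ q)) (ℚᵘ.≃-sym (ℚ.toℚᵘ-fromℚᵘ (p ℚᵘ.* q)))))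

fromℚᵘ-homo-+ : ∀ p q → ℚ.fromℚᵘ p ℚ.+ ℚ.fromℚᵘ q ≡ ℚ.fromℚᵘ (p ℚᵘ.+ q)
fromℚᵘ-homo-+ p q = ℚ.toℚᵘ-injective (ℚᵘ.≃-trans (ℚ.toℚᵘ-homo-+ (ℚ.fromℚᵘ p) (ℚ.fromℚᵘ q))
  (ℚᵘ.≃-trans (ℚᵘ.+-cong (ℚ.toℚᵘ-fromℚᵘ p) (ℚ.toℚᵘ-fromℚᵘ q)) (ℚᵘ.≃-sym (ℚ.toℚᵘ-fromℚᵘ (p ℚᵘ.+ q)))))

fromℚᵘ-mono-≤ : ∀ {p q} → p ℚᵘ.≤ q → ℚ.fromℚᵘ p ℚ.≤ ℚ.fromℚᵘ q
fromℚᵘ-mono-≤ {p} {q} p≤q = ℚ.toℚᵘ-cancel-≤ (ℚᵘ.≤-respˡ-≃ (ℚᵘ.≃-sym (ℚ.toℚᵘ-fromℚᵘ p))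
  (ℚᵘ.≤-respʳ-≃ (ℚᵘ.≃-sym (ℚ.toℚᵘ-fromℚᵘ q)) p≤q))

-- Opaque, as the normal form of + n / 1 contains an unfolded gcd.
opaque
  fromℕ : ℕ → ℚ
  fromℕ n = + n / 1

  fromℕ-/ : ∀ n → fromℕ n ≡ + n / 1
  fromℕ-/ n = refl

  fromℕ-0 : fromℕ 0 ≡ 0ℚ
  fromℕ-0 = refl

  fromℕ-1 : fromℕ 1 ≡ 1ℚ
  fromℕ-1 = refl

  /-*-cancel : ∀ n k .{{_ : NonZero k}} → (+ n / k) ℚ.* fromℕ k ≡ fromℕ n
  /-*-cancel n (suc k) = trans (fromℚᵘ-homo-* (mkℚᵘ (+ n) k) (mkℚᵘ (+ suc k) 0))
    (ℚ.fromℚᵘ-cong {mkℚᵘ (+ n) k ℚᵘ.* mkℚᵘ (+ suc k) 0} {mkℚᵘ (+ n) 0} (ℚᵘ.*≡*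
      (trans (ℤ.*-identityʳ _) (cong (λ m → + n ℤ.* + m) (sym (ℕ.*-identityʳ (suc k)))))))

  fromℕ-+ : ∀ m n → fromℕ (m ℕ.+ n) ≡ fromℕ m ℚ.+ fromℕ n
  fromℕ-+ m n = sym (trans (fromℚᵘ-homo-+ (mkℚᵘ (+ m) 0) (mkℚᵘ (+ n) 0))
    (ℚ.fromℚᵘ-cong {mkℚᵘ (+ m) 0 ℚᵘ.+ mkℚᵘ (+ n) 0} {mkℚᵘ (+ (m ℕ.+ n)) 0}
      (ℚᵘ.*≡* (cong (ℤ._* + 1) (cong₂ ℤ._+_ (ℤ.*-identityʳ (+ m)) (ℤ.*-identityʳ (+ n)))))))

  fromℕ-* : ∀ m n → fromℕ (m ℕ.* n) ≡ fromℕ m ℚ.* fromℕ n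
  fromℕ-* m n = sym (trans (fromℚᵘ-homo-* (mkℚᵘ (+ m) 0) (mkℚᵘ (+ n) 0))
    (ℚ.fromℚᵘ-cong {mkℚᵘ (+ m) 0 ℚᵘ.* mkℚᵘ (+ n) 0} {mkℚᵘ (+ (m ℕ.* n)) 0}
      (ℚᵘ.*≡* (cong (ℤ._* + 1) (sym (ℤ.pos-* m n))))))

  fromℕ-mono-≤ : ∀ {m n} → m ℕ.≤ n → fromℕ m ℚ.≤ fromℕ n
  fromℕ-mono-≤ {m} {n} m≤n = fromℚᵘ-mono-≤ {mkℚᵘ (+ m) 0} {mkℚᵘ (+ n) 0}
    (ℚᵘ.*≤* (ℤ.*-monoʳ-≤-nonNeg (+ 1) (ℤ.+≤+ m≤n)))

  fromℕ-positive : ∀ n .{{_ : NonZero n}} → 0ℚ ℚ.< fromℕ n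
  fromℕ-positive (suc n) = ℚ.<-≤-trans (ℚ.positive⁻¹ 1ℚ) (fromℕ-mono-≤ {1} {suc n} (s≤s z≤n))

  fromℕ-injective : ∀ {m n} → fromℕ m ≡ fromℕ n → m ≡ n
  fromℕ-injective {m} {n} eq with ℚ.fromℚᵘ-injective {mkℚᵘ (+ m) 0} {mkℚᵘ (+ n) 0} eq
  ... | ℚᵘ.*≡* eq′ = ℤ.+-injective (trans (sym (ℤ.*-identityʳ (+ m))) (trans eq′ (ℤ.*-identityʳ (+ n))))

  1≤*-denominator : ∀ {ε} → 0ℚ ℚ.< ε → ∃[ n ] 1ℚ ℚ.≤ fromℕ n ℚ.* ε
  1≤*-denominator {mkℚ (+ zero) d _} (ℚ.*<* (ℤ.+<+ ()))
  1≤*-denominator {ε@(mkℚ (+ suc p) d _)} _ = suc d , (begin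
    1ℚ                                                        ≤⟨ fromℚᵘ-mono-≤ {mkℚᵘ (+ 1) 0} bound ⟩
    ℚ.fromℚᵘ (mkℚᵘ (+ suc d) 0 ℚᵘ.* mkℚᵘ (+ suc p) d)
      ≡⟨ fromℚᵘ-homo-* (mkℚᵘ (+ suc d) 0) (mkℚᵘ (+ suc p) d) ⟨
    fromℕ (suc d) ℚ.* ℚ.fromℚᵘ (mkℚᵘ (+ suc p) d)             ≡⟨ cong (fromℕ (suc d) ℚ.*_) (ℚ.fromℚᵘ-toℚᵘ ε) ⟩
    fromℕ (suc d) ℚ.* ε                                       ∎)
    where
    open ℚ.≤-Reasoning
    bound : mkℚᵘ (+ 1) 0 ℚᵘ.≤ mkℚᵘ (+ suc d) 0 ℚᵘ.* mkℚᵘ (+ suc p) d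
    bound = ℚᵘ.*≤* (ℤ.+≤+ (ℕ.≤-trans (ℕ.≤-reflexive (cong suc (trans (ℕ.+-identityʳ _) (ℕ.+-identityʳ d))))
      (ℕ.≤-trans (ℕ.m≤m*n (suc d) (suc p)) (ℕ.≤-reflexive (sym (ℕ.*-identityʳ _))))))

infixr 8 ½^_
½^_ : ℕ → ℚ
½^ zero  = 1ℚ
½^ suc n = ½ ℚ.* ½^ n

½^-positive : ∀ n → 0ℚ ℚ.< ½^ n
½^-positive zero    = ℚ.positive⁻¹ 1ℚ
½^-positive (suc n) = ℚ.*-monoʳ-<-pos ½ (½^-positive n)

scale-positive : ∀ n {ε} → 0ℚ ℚ.< ε → 0ℚ ℚ.< ½^ n ℚ.* ε
scale-positive n {ε} ε>0 = subst (ℚ._< ½^ n ℚ.* ε) (ℚ.*-zeroˡ ε)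
  (ℚ.*-monoˡ-<-pos ε {{ℚ.positive ε>0}} (½^-positive n))

half-positive : ∀ {ε} → 0ℚ ℚ.< ε → 0ℚ ℚ.< ½ ℚ.* ε
half-positive ε>0 = ℚ.*-monoʳ-<-pos ½ ε>0

half+half : ∀ ε → ½ ℚ.* ε ℚ.+ ½ ℚ.* ε ≡ ε
half+half = solve 1 (λ ε → con ½ :* ε :+ con ½ :* ε := ε) refl
  where open +-*-Solver

scale-suc : ∀ n ε → ½^ suc n ℚ.* ε ≡ ½^ n ℚ.* (½ ℚ.* ε)
scale-suc n ε = solve 2 (λ p ε → (con ½ :* p) :* ε := p :* (con ½ :* ε)) refl (½^ n) ε
  where open +-*-Solver

p≤p+q : ∀ p {q} → 0ℚ ℚ.≤ q → p ℚ.≤ p ℚ.+ q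
p≤p+q p {q} q≥0 = subst (ℚ._≤ p ℚ.+ q) (ℚ.+-identityʳ p) (ℚ.+-monoʳ-≤ p q≥0)

+-cancelʳ-≤ : ∀ {p q} r → p ℚ.+ r ℚ.≤ q ℚ.+ r → p ℚ.≤ q
+-cancelʳ-≤ {p} {q} r le = begin
  p                        ≡⟨ undo p r ⟨
  (p ℚ.+ r) ℚ.+ ℚ.- r      ≤⟨ ℚ.+-monoˡ-≤ (ℚ.- r) le ⟩
  (q ℚ.+ r) ℚ.+ ℚ.- r      ≡⟨ undo q r ⟩
  q                        ∎
  where
  open ℚ.≤-Reasoning
  undo : ∀ p r → (p ℚ.+ r) ℚ.+ ℚ.- r ≡ p
  undo = solve 2 (λ p r → (p :+ r) :+ :- r := p) refl
    where open +-*-Solver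

*-monoˡ-≤ : ∀ {p q r} → 0ℚ ℚ.≤ r → p ℚ.≤ q → r ℚ.* p ℚ.≤ r ℚ.* q
*-monoˡ-≤ {r = r} r≥0 = ℚ.*-monoˡ-≤-nonNeg r {{ℚ.nonNegative r≥0}}

*-monoʳ-≤ : ∀ {p q r} → 0ℚ ℚ.≤ r → p ℚ.≤ q → p ℚ.* r ℚ.≤ q ℚ.* r
*-monoʳ-≤ {r = r} r≥0 = ℚ.*-monoʳ-≤-nonNeg r {{ℚ.nonNegative r≥0}}

half≤ : ∀ {ε} → 0ℚ ℚ.≤ ε → ½ ℚ.* ε ℚ.≤ ε
half≤ {ε} ε≥0 = subst (½ ℚ.* ε ℚ.≤_) (half+half ε) (p≤p+q (½ ℚ.* ε) (ℚ.*-monoˡ-≤-nonNeg ½ ε≥0))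

scale≤ : ∀ n {ε} → 0ℚ ℚ.≤ ε → ½^ n ℚ.* ε ℚ.≤ ε
scale≤ zero    {ε} ε≥0 = ℚ.≤-reflexive (ℚ.*-identityˡ ε)
scale≤ (suc n) {ε} ε≥0 = subst (ℚ._≤ ε) (sym (scale-suc n ε))
  (ℚ.≤-trans (scale≤ n (ℚ.*-monoˡ-≤-nonNeg ½ ε≥0)) (half≤ ε≥0))

½^-antitone : ∀ {m n} → m ℕ.≤ n → ½^ n ℚ.≤ ½^ m
½^-antitone {n = n} z≤n = subst (ℚ._≤ 1ℚ) (ℚ.*-identityʳ (½^ n)) (scale≤ n 0≤1ℚ)
½^-antitone (s≤s m≤n)   = ℚ.*-monoˡ-≤-nonNeg ½ (½^-antitone m≤n)

½^-*-fromℕ : ∀ n → ½^ n ℚ.* fromℕ n ℚ.≤ 1ℚ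
½^-*-fromℕ zero    = ℚ.≤-trans (ℚ.≤-reflexive (trans (ℚ.*-identityˡ _) fromℕ-0)) 0≤1ℚ
½^-*-fromℕ (suc n) = begin
  ½^ suc n ℚ.* fromℕ (suc n)
    ≡⟨ cong (½^ suc n ℚ.*_) (trans (fromℕ-+ 1 n) (cong (ℚ._+ fromℕ n) fromℕ-1)) ⟩
  (½ ℚ.* ½^ n) ℚ.* (1ℚ ℚ.+ fromℕ n)     ≡⟨ rearrange (½^ n) (fromℕ n) ⟩
  ½ ℚ.* (½^ n ℚ.* 1ℚ ℚ.+ ½^ n ℚ.* fromℕ n)
    ≤⟨ ℚ.*-monoˡ-≤-nonNeg ½ (ℚ.+-mono-≤ (scale≤ n 0≤1ℚ) (½^-*-fromℕ n)) ⟩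
  1ℚ                                    ∎
  where
  open ℚ.≤-Reasoning
  rearrange : ∀ p q → (½ ℚ.* p) ℚ.* (1ℚ ℚ.+ q) ≡ ½ ℚ.* (p ℚ.* 1ℚ ℚ.+ p ℚ.* q)
  rearrange = solve 2 (λ p q → (con ½ :* p) :* (con 1ℚ :+ q) :=
    con ½ :* (p :* con 1ℚ :+ p :* q)) refl
    where open +-*-Solver

opaque
  ½^-archimedean : ∀ {ε} → 0ℚ ℚ.< ε → ∃[ n ] ½^ n ℚ.≤ ε
  ½^-archimedean {ε} ε>0 with 1≤*-denominator ε>0
  ... | n , 1≤nε = n , (begin
    ½^ n                          ≡⟨ ℚ.*-identityʳ _ ⟨
    ½^ n ℚ.* 1ℚ                   ≤⟨ *-monoˡ-≤ (ℚ.<⇒≤ (½^-positive n)) 1≤nε ⟩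
    ½^ n ℚ.* (fromℕ n ℚ.* ε)      ≡⟨ ℚ.*-assoc (½^ n) (fromℕ n) ε ⟨
    (½^ n ℚ.* fromℕ n) ℚ.* ε      ≤⟨ *-monoʳ-≤ (ℚ.<⇒≤ ε>0) (½^-*-fromℕ n) ⟩
    1ℚ ℚ.* ε                      ≡⟨ ℚ.*-identityˡ ε ⟩
    ε                             ∎)
    where open ℚ.≤-Reasoning

-- A jump by `δ` is made of 2^n short steps; each level of the recursion joins two jumps by
-- `½ ℚ.* δ`.
jump : (a : ℕ → ℚ) → ∀ n δ → (∀ m → ∃[ k ] a m ℚ.+ ½^ n ℚ.* δ ℚ.< a k) →
  ∀ m → ∃[ k ] a m ℚ.+ δ ℚ.< a k
jump a zero    δ step m = subst (λ δ → ∃[ k ] a m ℚ.+ δ ℚ.< a k) (ℚ.*-identityˡ δ) (step m)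
jump a (suc n) δ step m = k₂ , (begin-strict
  a m ℚ.+ δ                           ≡⟨ cong (a m ℚ.+_) (half+half δ) ⟨
  a m ℚ.+ (½ ℚ.* δ ℚ.+ ½ ℚ.* δ)       ≡⟨ ℚ.+-assoc (a m) _ _ ⟨
  a m ℚ.+ ½ ℚ.* δ ℚ.+ ½ ℚ.* δ         <⟨ ℚ.+-monoˡ-< (½ ℚ.* δ) (proj₂ (half-step m)) ⟩
  a k₁ ℚ.+ ½ ℚ.* δ                    <⟨ proj₂ (half-step k₁) ⟩
  a k₂                                ∎)
  where
  open ℚ.≤-Reasoning
  half-step : ∀ m → ∃[ k ] a m ℚ.+ ½ ℚ.* δ ℚ.< a k
  half-step = jump a n (½ ℚ.* δ)
    λ m → subst (λ δ → ∃[ k ] a m ℚ.+ δ ℚ.< a k) (scale-suc n δ) (step m)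
  k₁ k₂ : ℕ
  k₁ = proj₁ (half-step m)
  k₂ = proj₁ (half-step k₁)

-- Almost maximal terms and compactness of 2^ℕ

module _ (em : ExcludedMiddle 0ℓ) where

  opaque
    -- Replaces the supremum, which need not be rational. If every term could be exceeded by more
    -- than `ε`, then `jump` would lead from `a 0` to a term above 1.
    almostMaximal : (a : ℕ → ℚ) → (∀ n → 0ℚ ℚ.≤ a n) → (∀ n → a n ℚ.≤ 1ℚ) →
      ∀ {ε} → 0ℚ ℚ.< ε → ∃[ m ] (∀ k → a k ℚ.≤ a m ℚ.+ ε)
    almostMaximal a a≥0 a≤1 {ε} ε>0 with em {∃[ m ] (∀ k → a k ℚ.≤ a m ℚ.+ ε)}
    ... | yes p = p
    ... | no ¬p = ⊥-elim (ℚ.<-irrefl refl (begin-strict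
        1ℚ               ≡⟨ ℚ.+-identityˡ 1ℚ ⟨
        0ℚ ℚ.+ 1ℚ        ≤⟨ ℚ.+-monoˡ-≤ 1ℚ (a≥0 0) ⟩
        a 0 ℚ.+ 1ℚ       <⟨ proj₂ far ⟩
        a (proj₁ far)    ≤⟨ a≤1 _ ⟩
        1ℚ               ∎))
      where
      open ℚ.≤-Reasoning
      step : ∀ m → ∃[ k ] a m ℚ.+ ε ℚ.< a k
      step m with em {∃[ k ] a m ℚ.+ ε ℚ.< a k}
      ... | yes q = q
      ... | no ¬q = contradiction (m , λ k → ℚ.≮⇒≥ λ lt → ¬q (k , lt)) ¬p
      n : ℕ
      n = proj₁ (½^-archimedean ε>0)
      far : ∃[ k ] a 0 ℚ.+ 1ℚ ℚ.< a k
      far = jump a n 1ℚ (λ m → let (k , lt) = step m in k , ℚ.≤-<-trans (ℚ.+-monoʳ-≤ (a m)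
        (ℚ.≤-trans (ℚ.≤-reflexive (ℚ.*-identityʳ (½^ n))) (proj₂ (½^-archimedean ε>0)))) lt) 0

  -- Compactness of 2^ℕ: a branch avoiding every W n is built bit by bit.

  private
    Increasing Coverable : (ℕ → Sequence → Bool) → Set
    Increasing W = ∀ {n y} → W n y ≡ true → W (suc n) y ≡ true
    Coverable W  = ∃[ n ] (∀ y → W n y ≡ true)

    increasing-+ : ∀ {W} → Increasing W → ∀ k {n y} → W n y ≡ true → W (k ℕ.+ n) y ≡ true
    increasing-+ inc zero    eq = eq
    increasing-+ {W} inc (suc k) {n} {y} eq = inc {k ℕ.+ n} {y} (increasing-+ {W} inc k eq)

    Uncovered : Set
    Uncovered = Σ[ W ∈ (ℕ → Sequence → Bool) ]
      Increasing W × (∀ n → Extensional (W n)) × ¬ Coverable W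

    branch : (s : Uncovered) → ∃[ b ] ¬ Coverable (λ n → proj₁ s n ∘ (b ◂_))
    branch (W , inc , ext , ¬cov) with em {Coverable (λ n → W n ∘ (false ◂_))}
    ... | no ¬cov₀         = false , ¬cov₀
    ... | yes (n₀ , full₀) = true , λ (n₁ , full₁) → ¬cov (n₁ ℕ.+ n₀ , λ y →
        trans (ext _ _ _ (◂-η y)) (case-head full₁ (y 0) (y ∘ suc)))
      where
      case-head : ∀ {n₁} → (∀ y → W n₁ (true ◂ y) ≡ true) → ∀ b y → W (n₁ ℕ.+ n₀) (b ◂ y) ≡ true
      case-head {n₁} full₁ false y = increasing-+ {W} inc n₁ (full₀ y)
      case-head {n₁} full₁ true  y =
        subst (λ n → W n (true ◂ y) ≡ true) (ℕ.+-comm n₀ n₁) (increasing-+ {W} inc n₀ (full₁ y))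

    next : Uncovered → Uncovered
    next s@(W , inc , ext , _) =
      (λ n → W n ∘ (proj₁ (branch s) ◂_)) , inc , (λ n → extensional-◂ _ (ext n)) , proj₂ (branch s)

    path : Uncovered → Sequence
    path s zero    = proj₁ (branch s)
    path s (suc i) = path (next s) i

    -- Once the `m` relevant bits of the path have been read, the `n`-th set has become constant, so
    -- being true on the path would make it cover everything.
    path-escapes : ∀ m (s : Uncovered) n → Local m (proj₁ s n) → proj₁ s n (path s) ≢ true
    path-escapes zero (W , _ , _ , ¬cov) n loc eq =
      ¬cov (n , λ y → trans (loc y _ λ _ ()) eq)
    path-escapes (suc m) s@(W , _ , ext , _) n loc eq =
      path-escapes m (next s) n (local-◂ _ loc) (trans (ext n _ _ (λ i → sym (◂-η (path s) i))) eq)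

  opaque
    compactness : (W : ℕ → Clopen) → (∀ n → W n ⊆ᶜ W (suc n)) →
      (∀ y → ∃[ n ] y ∈ᶜ W n) → ∃[ n ] (∀ y → y ∈ᶜ W n)
    compactness W inc covers = decidable-stable em λ ¬cov →
      let s : Uncovered
          s = (λ n → contains (W n)) , (λ {n} → inc n) , (λ n → local⇒extensional (local (W n))) , ¬cov
          (n , y∈W) = covers (path s)
      in path-escapes (size (W n)) s n (local (W n)) y∈W

-- A lies in an open set of measure at most ε, presented as an increasing
-- union of clopen sets.
record Small (ε : ℚ) (A : Pred Sequence ℓ) : Set ℓ where
  field
    cover         : ℕ → Clopen
    increasing    : ∀ n → cover n ⊆ᶜ cover (suc n)
    cover-measure : ∀ n → measure (cover n) ℚ.≤ ε
    covers        : ∀ {y} → y ∈ A → ∃[ n ] y ∈ᶜ cover n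

open Small

-- Together with the complement of `C`, the stages of the cover exhaust 2^ℕ; by compactness a single
-- stage already contains `C`.
small-clopen : ExcludedMiddle 0ℓ → ∀ C {ε} → Small ε (_∈ᶜ C) → measure C ℚ.≤ ε
small-clopen em C {ε} S =
  ℚ.≤-trans (measure-mono C (cover S (proj₁ all)) C⊆) (cover-measure S _)
  where
  W : ℕ → Clopen
  W n = ∁ᶜ C ∪ᶜ cover S n
  covered : ∀ y → ∃[ n ] y ∈ᶜ W n
  covered y with ∈ᶜ? C y
  ... | inj₁ y∈C = let (n , y∈) = covers S y∈C in n , ∈-∪ᶜ⁺ʳ (∁ᶜ C) (cover S n) y∈
  ... | inj₂ y∉C = 0 , ∈-∪ᶜ⁺ˡ (∁ᶜ C) (cover S 0) (cong not y∉C)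
  inc : ∀ n → W n ⊆ᶜ W (suc n)
  inc n y∈ with ∈-∪ᶜ⁻ (∁ᶜ C) (cover S n) y∈
  ... | inj₁ y∉C = ∈-∪ᶜ⁺ˡ (∁ᶜ C) (cover S (suc n)) y∉C
  ... | inj₂ y∈V = ∈-∪ᶜ⁺ʳ (∁ᶜ C) (cover S (suc n)) (increasing S n y∈V)
  all : ∃[ n ] (∀ y → y ∈ᶜ W n)
  all = compactness em W inc covered
  C⊆ : C ⊆ᶜ cover S (proj₁ all)
  C⊆ {y} y∈C with ∈-∪ᶜ⁻ (∁ᶜ C) (cover S (proj₁ all)) (proj₂ all y)
  ... | inj₁ y∉C = contradiction y∈C (∈-∁ᶜ⁻ C y∉C)
  ... | inj₂ y∈V = y∈V

small-⊆ : ∀ {ε δ} {A : Pred Sequence ℓ} {B : Pred Sequence ℓ′} →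
  A ⊆ B → ε ℚ.≤ δ → Small ε B → Small δ A
small-⊆ A⊆B ε≤δ S = record
  { cover         = cover S
  ; increasing    = increasing S
  ; cover-measure = λ n → ℚ.≤-trans (cover-measure S n) ε≤δ
  ; covers        = covers S ∘ A⊆B
  }

small-∅ : ∀ {ε} {A : Pred Sequence ℓ} → 0ℚ ℚ.≤ ε → (∀ {y} → ¬ y ∈ A) → Small ε A
small-∅ ε≥0 empty = record
  { cover         = λ _ → ∅ᶜ
  ; increasing    = λ _ ()
  ; cover-measure = λ _ → ε≥0
  ; covers        = λ y∈A → contradiction y∈A empty
  }

small-∈ᶜ : ∀ {ε} {A : Pred Sequence ℓ} C → measure C ℚ.≤ ε → (∀ {y} → y ∈ A → y ∈ᶜ C) → Small ε A
small-∈ᶜ C C≤ε A⊆C = record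
  { cover         = λ _ → C
  ; increasing    = λ _ y∈C → y∈C
  ; cover-measure = λ _ → C≤ε
  ; covers        = λ y∈A → 0 , A⊆C y∈A
  }

small-∪ : ∀ {ε δ} {A : Pred Sequence ℓ} {B : Pred Sequence ℓ′} →
  Small ε A → Small δ B → Small (ε ℚ.+ δ) (A ∪ B)
small-∪ S T = record
  { cover         = λ n → cover S n ∪ᶜ cover T n
  ; increasing    = λ n y∈ → case ∈-∪ᶜ⁻ (cover S n) (cover T n) y∈ of λ
      { (inj₁ y∈S) → ∈-∪ᶜ⁺ˡ (cover S (suc n)) (cover T (suc n)) (increasing S n y∈S)
      ; (inj₂ y∈T) → ∈-∪ᶜ⁺ʳ (cover S (suc n)) (cover T (suc n)) (increasing T n y∈T) }
  ; cover-measure = λ n → ℚ.≤-trans (measure-∪ (cover S n) (cover T n))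
      (ℚ.+-mono-≤ (cover-measure S n) (cover-measure T n))
  ; covers        = λ
      { (inj₁ y∈A) → let (n , y∈) = covers S y∈A in n , ∈-∪ᶜ⁺ˡ (cover S n) (cover T n) y∈
      ; (inj₂ y∈B) → let (n , y∈) = covers T y∈B in n , ∈-∪ᶜ⁺ʳ (cover S n) (cover T n) y∈ }
  }

small-preimage : ∀ {ε κ} {A : Pred Sequence ℓ} → (∀ {i j} → κ i ≡ κ j → i ≡ j) →
  Small ε A → Small ε (λ y → y ∘ κ ∈ A)
small-preimage {κ = κ} κ-inj S = record
  { cover         = preimage κ ∘ cover S
  ; increasing    = λ n → increasing S n
  ; cover-measure = λ n → ℚ.≤-trans (ℚ.≤-reflexive (measure-preimage (cover S n) κ-inj)) (cover-measure S n)
  ; covers        = λ y∈A → covers S y∈A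
  }

-- The summand `½^ n ℚ.* ε` is the budget left for the sets from `n` on; carrying it along makes the
-- induction close.
⋃ᶜ-measure : ∀ (C : ℕ → Clopen) {ε} → (∀ i → measure (C i) ℚ.≤ ½^ suc i ℚ.* ε) →
  ∀ n → measure (⋃ᶜ C n) ℚ.+ ½^ n ℚ.* ε ℚ.≤ ε
⋃ᶜ-measure C {ε} C≤ zero    = ℚ.≤-reflexive (trans (ℚ.+-identityˡ _) (ℚ.*-identityˡ ε))
⋃ᶜ-measure C {ε} C≤ (suc n) = begin
  measure (⋃ᶜ C n ∪ᶜ C n) ℚ.+ ½^ suc n ℚ.* ε
    ≤⟨ ℚ.+-monoˡ-≤ (½^ suc n ℚ.* ε) (measure-∪ (⋃ᶜ C n) (C n)) ⟩
  measure (⋃ᶜ C n) ℚ.+ measure (C n) ℚ.+ ½^ suc n ℚ.* ε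
    ≤⟨ ℚ.+-monoˡ-≤ (½^ suc n ℚ.* ε) (ℚ.+-monoʳ-≤ (measure (⋃ᶜ C n)) (C≤ n)) ⟩
  measure (⋃ᶜ C n) ℚ.+ ½^ suc n ℚ.* ε ℚ.+ ½^ suc n ℚ.* ε
    ≡⟨ rearrange (measure (⋃ᶜ C n)) (½^ n) ε ⟩
  measure (⋃ᶜ C n) ℚ.+ ½^ n ℚ.* ε
    ≤⟨ ⋃ᶜ-measure C C≤ n ⟩
  ε ∎
  where
  open ℚ.≤-Reasoning
  rearrange : ∀ m p ε → m ℚ.+ (½ ℚ.* p) ℚ.* ε ℚ.+ (½ ℚ.* p) ℚ.* ε ≡ m ℚ.+ p ℚ.* ε
  rearrange = solve 3 (λ m p ε →
    m :+ (con ½ :* p) :* ε :+ (con ½ :* p) :* ε := m :+ p :* ε) refl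
    where open +-*-Solver

small-⋃ : ∀ {ε} {A : ℕ → Pred Sequence ℓ} → 0ℚ ℚ.≤ ε →
  (∀ i → Small (½^ suc i ℚ.* ε) (A i)) → Small ε (λ y → ∃[ i ] y ∈ A i)
small-⋃ {ε = ε} {A} ε≥0 S = record
  { cover         = V
  ; increasing    = λ n y∈ → let (i , i<n , y∈ᵢ) = ∈-⋃ᶜ⁻ _ n y∈ in
      ∈-⋃ᶜ⁺ _ (ℕ.m<n⇒m<1+n i<n) (increasing (S i) n y∈ᵢ)
  ; cover-measure = λ n → ℚ.≤-trans
      (p≤p+q _ (ℚ.≤-trans (ℚ.≤-reflexive (sym (ℚ.*-zeroʳ (½^ n))))
        (*-monoˡ-≤ (ℚ.<⇒≤ (½^-positive n)) ε≥0)))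
      (⋃ᶜ-measure (λ i → cover (S i) n) (λ i → cover-measure (S i) n) n)
  ; covers        = λ (i , y∈A) → let (n , y∈) = covers (S i) y∈A in
      -- The stage must exceed `i` for the `i`-th cover to take part, and be at least `n` for that
      -- cover to have reached the point.
      suc i ℕ.+ n , ∈-⋃ᶜ⁺ _ (ℕ.m≤m+n (suc i) n) (later (S i) (suc i) y∈)
  }
  where
  V : ℕ → Clopen
  -- A diagonal: stage `n` uses only the first `n` covers, each at its own stage `n`, and so remains
  -- clopen.
  V n = ⋃ᶜ (λ i → cover (S i) n) n
  later : ∀ {δ} {B : Pred Sequence _} (T : Small δ B) k {n y} → y ∈ᶜ cover T n → y ∈ᶜ cover T (k ℕ.+ n)
  later T zero    y∈ = y∈
  later T (suc k) y∈ = increasing T _ (later T k y∈)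

-- Approximation of sets by clopen sets

module _ {F : Pred Sequence ℓ} where

  -- The symmetric difference is taken inside `F` only, since `A` says nothing about sequences
  -- outside `F`. For free sequences, that remainder is treated in `small-nonfree`.
  Difference : Clopen → Pred (Σ Sequence F) ℓ′ → Pred Sequence _
  Difference C A y = Σ[ f ∈ F y ] ((y ∈ᶜ C × ¬ (y , f) ∈ A) ⊎ (¬ y ∈ᶜ C × (y , f) ∈ A))

  Approximable : Pred (Σ Sequence F) ℓ′ → Set _
  Approximable A = ∀ {ε} → 0ℚ ℚ.< ε → Σ[ C ∈ Clopen ] Small ε (Difference C A)

  approximable-≐ : {A : Pred (Σ Sequence F) ℓ′} {B : Pred (Σ Sequence F) ℓ″} →
    A ≐ B → Approximable A → Approximable B
  approximable-≐ (A⊆B , B⊆A) apx ε>0 with apx ε>0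
  ... | C , S = C , small-⊆ (λ
    { (f , inj₁ (y∈C , y∉B)) → f , inj₁ (y∈C , y∉B ∘ A⊆B)
    ; (f , inj₂ (y∉C , y∈B)) → f , inj₂ (y∉C , B⊆A y∈B) }) ℚ.≤-refl S

  approximable-clopen : ∀ C → Approximable {ℓ′ = 0ℓ} (λ (y , _) → y ∈ᶜ C)
  approximable-clopen C ε>0 = C , small-∅ (ℚ.<⇒≤ ε>0) λ
    { (_ , inj₁ (y∈C , y∉C)) → y∉C y∈C
    ; (_ , inj₂ (y∉C , y∈C)) → y∉C y∈C }

  approximable-∁ : ExcludedMiddle ℓ′ → {A : Pred (Σ Sequence F) ℓ′} →
    Approximable A → Approximable (∁ A)
  approximable-∁ em {A} apx ε>0 with apx ε>0
  ... | C , S = ∁ᶜ C , small-⊆ flip ℚ.≤-refl S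
    where
    flip : Difference (∁ᶜ C) (∁ A) ⊆ Difference C A
    flip {y} (f , inj₁ (y∉C , ¬¬A)) with em {(y , f) ∈ A}
    ... | yes y∈A = f , inj₂ (∈-∁ᶜ⁻ C y∉C , y∈A)
    ... | no y∉A  = contradiction y∉A ¬¬A
    flip {y} (f , inj₂ (y∈C , y∉A)) with ∈ᶜ? C y
    ... | inj₁ y∈ = f , inj₁ (y∈ , y∉A)
    ... | inj₂ y∉ = contradiction (cong not y∉) y∈C

  difference-⋃ : ∀ (C : ℕ → Clopen) m (A : ℕ → Pred (Σ Sequence F) ℓ′) →
    Difference (⋃ᶜ C m) (⋃ ℕ A) ⊆
      (λ y → ∃[ n ] y ∈ Difference (C n) (A n)) ∪ (λ y → ∃[ k ] y ∈ᶜ ⋃ᶜ C (k ℕ.+ m) ∖ᶜ ⋃ᶜ C m)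
  difference-⋃ C m A (f , inj₁ (y∈U , y∉A)) with ∈-⋃ᶜ⁻ C m y∈U
  ... | n , _ , y∈C = inj₁ (n , f , inj₁ (y∈C , λ y∈A → y∉A (n , y∈A)))
  difference-⋃ C m A {y} (f , inj₂ (y∉U , n , y∈A)) with ∈ᶜ? (C n) y
  ... | inj₂ y∉C = inj₁ (n , f , inj₂ ((λ y∈C → case trans (sym y∈C) y∉C of λ ()) , y∈A))
  ... | inj₁ y∈C = inj₂ (suc n , ∈-∩ᶜ⁺ (⋃ᶜ C (suc n ℕ.+ m)) (∁ᶜ (⋃ᶜ C m))
      (∈-⋃ᶜ⁺ C (ℕ.m≤m+n (suc n) m) y∈C) (∈-∁ᶜ⁺ (⋃ᶜ C m) y∉U))

  -- The union of all approximants is exhausted, up to ½ ε, by finitely many.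
  approximable-⋃ : ExcludedMiddle 0ℓ → {A : ℕ → Pred (Σ Sequence F) ℓ′} →
    (∀ n → Approximable (A n)) → Approximable (⋃ ℕ A)
  approximable-⋃ em {A} apx {ε} ε>0 = U m ,
    small-⊆ {A = Difference (U m) (⋃ ℕ A)} {B = errors ∪ rest}
      (difference-⋃ (proj₁ ∘ C) m A) (ℚ.≤-reflexive (half+half ε)) (small-∪ small-errors tail)
    where
    δ>0 = half-positive ε>0
    δ≥0 = ℚ.<⇒≤ δ>0
    C : ∀ n → Σ[ C ∈ Clopen ] Small (½^ suc n ℚ.* (½ ℚ.* ε)) (Difference C (A n))
    C n = apx n (scale-positive (suc n) δ>0)
    U : ℕ → Clopen
    U = ⋃ᶜ (proj₁ ∘ C)
    maximal : ∃[ m ] (∀ k → measure (U k) ℚ.≤ measure (U m) ℚ.+ ½ ℚ.* ε)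
    maximal = almostMaximal em (measure ∘ U) (measure-nonNeg ∘ U) (measure-≤1 ∘ U) δ>0
    m = proj₁ maximal

    U-mono : ∀ k → U m ⊆ᶜ U (k ℕ.+ m)
    U-mono zero    y∈ = y∈
    U-mono (suc k) y∈ = ∈-∪ᶜ⁺ˡ (U (k ℕ.+ m)) (proj₁ (C (k ℕ.+ m))) (U-mono k y∈)

    errors rest : Pred Sequence _
    errors y = ∃[ n ] y ∈ Difference (proj₁ (C n)) (A n)
    rest y = ∃[ k ] y ∈ᶜ U (k ℕ.+ m) ∖ᶜ U m

    small-errors : Small (½ ℚ.* ε) errors
    small-errors = small-⋃ {ε = ½ ℚ.* ε} {A = λ n → Difference (proj₁ (C n)) (A n)} δ≥0 (λ n → proj₂ (C n))

    tail : Small (½ ℚ.* ε) rest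
    tail = record
      { cover         = λ k → U (k ℕ.+ m) ∖ᶜ U m
      ; increasing    = λ k y∈ → let (y∈U , y∉) = ∈-∩ᶜ⁻ (U (k ℕ.+ m)) (∁ᶜ (U m)) y∈ in
          ∈-∩ᶜ⁺ (U (suc k ℕ.+ m)) (∁ᶜ (U m)) (∈-∪ᶜ⁺ˡ (U (k ℕ.+ m)) (proj₁ (C (k ℕ.+ m))) y∈U) y∉
      ; cover-measure = λ k → +-cancelʳ-≤ (measure (U m)) (begin
          measure (U (k ℕ.+ m) ∖ᶜ U m) ℚ.+ measure (U m)   ≤⟨ measure-∖ (U (k ℕ.+ m)) (U m) (U-mono k) ⟩
          measure (U (k ℕ.+ m))                            ≤⟨ proj₂ maximal (k ℕ.+ m) ⟩
          measure (U m) ℚ.+ ½ ℚ.* ε                        ≡⟨ ℚ.+-comm (measure (U m)) _ ⟩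
          ½ ℚ.* ε ℚ.+ measure (U m)                        ∎)
      ; covers        = λ y∈ → y∈
      }
      where open ℚ.≤-Reasoning

-- Configurations coded as bit sequences

module Coding {g} (em : ExcludedMiddle (lsuc g)) (Γ : Group g g)
  (countable : Countable (Group.setoid Γ)) where

  open Group Γ public
    using (Carrier; _∙_; ε; _⁻¹; ⁻¹-cong; ∙-cong; ∙-congʳ; ∙-congˡ; assoc;
           identityˡ; identityʳ; inverseˡ; inverseʳ)
    renaming (_≈_ to _≈ᴳ_; _≉_ to _≉ᴳ_; refl to reflᴳ; sym to symᴳ; trans to transᴳ)
  open GroupProperties Γ using (∙-cancelʳ; identityʳ-unique)
  open Bernoulli Γ public
  open Action (shift) public using () renaming (_·_ to _·ˢ_)

  infix 4 _≈ˣ_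
  _≈ˣ_ : Configuration → Configuration → Set g
  _≈ˣ_ = Setoid._≈_ 2^Γ

  em-g : ExcludedMiddle g
  em-g {P} = map′ lower lift (em {Lift (lsuc g) P})

  em-0 : ExcludedMiddle 0ℓ
  em-0 {P} = map′ lower lift (em {Lift (lsuc g) P})

  code : Carrier → ℕ
  code = Injection.to countable

  code-cong : ∀ {γ δ} → γ ≈ᴳ δ → code γ ≡ code δ
  code-cong = Injection.cong countable

  code-injective : ∀ {γ δ} → code γ ≡ code δ → γ ≈ᴳ δ
  code-injective = Injection.injective countable

  config : Sequence → Configuration
  config y = record { to = y ∘ code ; cong = cong y ∘ code-cong }

  Coded : ℕ → Set g
  Coded i = ∃[ γ ] code γ ≡ i

  -- Right translation by σ, fixing the indices that code no group element.
  translate : Carrier → ℕ → ℕ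
  translate σ i with em-g {Coded i}
  ... | yes (γ , _) = code (γ ∙ σ)
  ... | no _        = i

  translate-code : ∀ σ γ → translate σ (code γ) ≡ code (γ ∙ σ)
  translate-code σ γ with em-g {Coded (code γ)}
  ... | yes (γ′ , eq) = code-cong (∙-congʳ (code-injective eq))
  ... | no ¬coded     = contradiction (γ , refl) ¬coded

  translate-injective : ∀ σ {i j} → translate σ i ≡ translate σ j → i ≡ j
  translate-injective σ {i} {j} eq with em-g {Coded i} | em-g {Coded j}
  ... | yes (γ , refl) | yes (δ , refl) = code-cong (∙-cancelʳ σ γ δ (code-injective eq))
  ... | yes (γ , refl) | no ¬coded      = contradiction (γ ∙ σ , eq) ¬coded
  ... | no ¬coded      | yes (δ , refl) = contradiction (δ ∙ σ , sym eq) ¬coded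
  ... | no _           | no _           = eq

  config-translate : ∀ σ y → config (y ∘ translate σ) ≈ˣ σ ·ˢ config y
  config-translate σ y γ = cong y (translate-code σ γ)

  FreeSequence : Pred Sequence g
  FreeSequence y = IsFree shift (config y)

  onSequences : Pred (Setoid.Carrier Free) g → Pred (Σ Sequence FreeSequence) g
  onSequences A (y , free) = A (config y , free)

  -- Approximable sets include the coordinate sets and are closed under complements and countable
  -- unions.
  borel⇒approximable : ∀ {A} → BorelFree A → Approximable (onSequences A)
  borel⇒approximable (generator γ (A⊆ , ⊆A)) =
    approximable-≐
      ((λ {(y , _)} → ⊆A ∘ ∈-bit⁻ (code γ) true y) , λ {(y , _)} → ∈-bit⁺ (code γ) true y ∘ A⊆)
      (approximable-clopen (bit (code γ) true))
  borel⇒approximable (complement b) = approximable-∁ em-g (borel⇒approximable b)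
  borel⇒approximable (union b) = approximable-⋃ em-0 (λ n → borel⇒approximable (b n))
  borel⇒approximable (resp (A⊆B , B⊆A) b) = approximable-≐ (A⊆B , B⊆A) (borel⇒approximable b)

  cylinder : List (Carrier × Bool) → Clopen
  cylinder []             = fullᶜ
  cylinder ((γ , b) ∷ cs) = bit (code γ) b ∩ᶜ cylinder cs

  ∈-cylinder : ∀ {y} cs → All (λ (γ , b) → config y ⟨$⟩ γ ≡ b) cs → y ∈ᶜ cylinder cs
  ∈-cylinder []             []         = refl
  ∈-cylinder {y} ((γ , b) ∷ cs) (eq ∷ eqs) =
    ∈-∩ᶜ⁺ (bit (code γ) b) (cylinder cs) {y} (∈-bit⁺ (code γ) b y eq) (∈-cylinder cs eqs)

  cylinder-update : ∀ γ cs → All (γ ≉ᴳ_) (map proj₁ cs) → ∀ c y →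
    contains (cylinder cs) (update (code γ) c y) ≡ contains (cylinder cs) y
  cylinder-update γ []             []           c y = refl
  cylinder-update γ ((δ , b) ∷ cs) (γ≉δ ∷ rest) c y = cong₂ (λ d → ⌊ d Bool.≟ b ⌋ ∧_)
    (update-other c y λ eq → γ≉δ (code-injective (sym eq))) (cylinder-update γ cs rest c y)

  measure-cylinder : ∀ C → measure (cylinder (Cylinder.constraints C)) ≡ mass C
  measure-cylinder record { constraints = [] ; distinct = _ } = refl
  measure-cylinder record { constraints = (γ , b) ∷ cs ; distinct = γ∉cs ∷ distinct } = trans
    (measure-bit-∩ (code γ) b (cylinder cs) (cylinder-update γ cs γ∉cs))
    (cong (½ ℚ.*_) (measure-cylinder record { constraints = cs ; distinct = distinct }))

  mass≡½^ : ∀ C → mass C ≡ ½^ length (Cylinder.constraints C)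
  mass≡½^ record { constraints = [] ; distinct = _ } = refl
  mass≡½^ record { constraints = _ ∷ cs ; distinct = _ ∷ distinct } =
    cong (½ ℚ.*_) (mass≡½^ record { constraints = cs ; distinct = distinct })

  maybeCylinder : Maybe Cylinder → Clopen
  maybeCylinder = maybe′ (cylinder ∘ Cylinder.constraints) ∅ᶜ

  ⋃-cylinders : (ℕ → Maybe Cylinder) → ℕ → Clopen
  ⋃-cylinders C = ⋃ᶜ (maybeCylinder ∘ C)

  ⋃-cylinders-measure : ∀ C n →
    measure (⋃-cylinders C n) ℚ.≤ partialSum (λ i → maybe′ mass 0ℚ (C i)) n
  ⋃-cylinders-measure C zero    = ℚ.≤-refl
  ⋃-cylinders-measure C (suc n) = ℚ.≤-trans (measure-∪ (⋃-cylinders C n) (maybeCylinder (C n)))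
    (ℚ.+-mono-≤ (⋃-cylinders-measure C n) last)
    where
    last : measure (maybeCylinder (C n)) ℚ.≤ maybe′ mass 0ℚ (C n)
    last with C n
    ... | just c  = ℚ.≤-reflexive (measure-cylinder c)
    ... | nothing = ℚ.≤-refl

  null⇒small : ∀ {M} → βFree M ≤ᴿ fromℚ 0ℚ → ∀ {δ} → 0ℚ ℚ.< δ →
    Small δ (λ y → Σ[ free ∈ FreeSequence y ] (config y , free) ∈ M)
  null⇒small null δ>0 with null δ>0
  ... | (C , cov) , r , r<δ , sum<r = record
    { cover         = ⋃-cylinders C
    ; increasing    = λ n {y} → ∈-∪ᶜ⁺ˡ (⋃-cylinders C n) (maybeCylinder (C n)) {y}
    ; cover-measure = λ n → ℚ.≤-trans (⋃-cylinders-measure C n) (ℚ.<⇒≤ (ℚ.<-trans (sum<r n) r<δ))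
    ; covers        = λ {y} y∈M → let (n , y∈) = cov y∈M in
        suc n , ∈-∪ᶜ⁺ʳ (⋃-cylinders C n) (maybeCylinder (C n)) {y} (in-cylinder (C n) y∈)
    }
    where
    in-cylinder : ∀ {y} c → maybe′ (λ c → config y ∈ ⟦ c ⟧) ⊥ₚ c →
      y ∈ᶜ maybeCylinder c
    in-cylinder {y} (just c) y∈ = ∈-cylinder {y} (Cylinder.constraints c) y∈

  -- Infinite groups: almost every sequence is free

  Infinite : Set g
  Infinite = ∀ n → ∃[ γ ] n ℕ.≤ code γ

  module _ (infinite : Infinite) where

    -- Multiplication by `γ ⁻¹` sends the indices below `n` below some `b`. If `code δ` is at least
    -- `n ℕ.+ b`, then `δ ∙ γ` cannot have a code below `n`.
    far : ∀ γ n → ∃[ δ ] n ℕ.≤ code δ × n ℕ.≤ code (δ ∙ γ)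
    far γ n with boundBelow (translate (γ ⁻¹)) n
    ... | b , <b with infinite (n ℕ.+ b)
    ...   | δ , n+b≤δ = δ , ℕ.≤-trans (ℕ.m≤m+n n b) n+b≤δ , ℕ.≮⇒≥ λ δγ<n →
              ℕ.<-irrefl refl (ℕ.<-≤-trans (subst (ℕ._< b) back (<b δγ<n))
                (ℕ.≤-trans (ℕ.m≤n+m b n) n+b≤δ))
      where
      back : translate (γ ⁻¹) (code (δ ∙ γ)) ≡ code δ
      back = trans (translate-code (γ ⁻¹) (δ ∙ γ)) (code-cong
        (transᴳ (assoc δ γ (γ ⁻¹)) (transᴳ (∙-congˡ (inverseʳ γ)) (identityʳ δ))))

    agree : ℕ → ℕ → Clopen → Clopen
    agree a a′ C = (bit a false ∩ᶜ (bit a′ false ∩ᶜ C)) ∪ᶜ (bit a true ∩ᶜ (bit a′ true ∩ᶜ C))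

    ∈-agree : ∀ a a′ C {y} → y a ≡ y a′ → y ∈ᶜ C → y ∈ᶜ agree a a′ C
    ∈-agree a a′ C {y} eq y∈C = by-value (y a) refl
      where
      half : Bool → Clopen
      half b = bit a b ∩ᶜ (bit a′ b ∩ᶜ C)
      ∈-half : ∀ {b} → y a ≡ b → y ∈ᶜ half b
      ∈-half {b} ya = ∈-∩ᶜ⁺ (bit a b) (bit a′ b ∩ᶜ C) {y} (∈-bit⁺ a b y ya)
        (∈-∩ᶜ⁺ (bit a′ b) C {y} (∈-bit⁺ a′ b y (trans (sym eq) ya)) y∈C)
      by-value : ∀ b → y a ≡ b → y ∈ᶜ agree a a′ C
      by-value false ya = ∈-∪ᶜ⁺ˡ (half false) (half true) {y} (∈-half ya)
      by-value true  ya = ∈-∪ᶜ⁺ʳ (half false) (half true) {y} (∈-half ya)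

    -- Both bits lie beyond the window of `C`, so each of the two common values occurs on a quarter
    -- of `C`.
    measure-agree : ∀ {a a′} C → size C ℕ.≤ a → size C ℕ.≤ a′ → a ≢ a′ →
      measure (agree a a′ C) ℚ.≤ ½ ℚ.* measure C
    measure-agree {a} {a′} C C≤a C≤a′ a≢a′ = begin
      measure (agree a a′ C)
        ≤⟨ measure-∪ (bit a false ∩ᶜ (bit a′ false ∩ᶜ C)) (bit a true ∩ᶜ (bit a′ true ∩ᶜ C)) ⟩
      measure (bit a false ∩ᶜ (bit a′ false ∩ᶜ C)) ℚ.+ measure (bit a true ∩ᶜ (bit a′ true ∩ᶜ C))
        ≡⟨ cong₂ ℚ._+_ (quarter false) (quarter true) ⟩
      ½ ℚ.* (½ ℚ.* measure C) ℚ.+ ½ ℚ.* (½ ℚ.* measure C)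
        ≡⟨ half+half (½ ℚ.* measure C) ⟩
      ½ ℚ.* measure C ∎
      where
      open ℚ.≤-Reasoning
      untouched : ∀ {a} → size C ℕ.≤ a → ∀ c y → contains C (update a c y) ≡ contains C y
      untouched C≤a c y = local C _ _ λ i i<C → update-other c y (ℕ.<⇒≢ (ℕ.<-≤-trans i<C C≤a))
      quarter : ∀ b → measure (bit a b ∩ᶜ (bit a′ b ∩ᶜ C)) ≡ ½ ℚ.* (½ ℚ.* measure C)
      quarter b = trans
        (measure-bit-∩ a b (bit a′ b ∩ᶜ C) λ c y →
          cong₂ (λ d → ⌊ d Bool.≟ b ⌋ ∧_) (update-other c y (a≢a′ ∘ sym)) (untouched C≤a c y))
        (cong (½ ℚ.*_) (measure-bit-∩ a′ b C (untouched C≤a′)))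

    -- A configuration fixed by γ agrees at δ and δγ for every δ.
    small-fixed : ∀ {γ} → γ ≉ᴳ ε → ∀ n →
      Σ[ C ∈ Clopen ] measure C ℚ.≤ ½^ n × (∀ {y} → γ ·ˢ config y ≈ˣ config y → y ∈ᶜ C)
    small-fixed γ≉ε zero = fullᶜ , ℚ.≤-refl , λ _ → refl
    small-fixed {γ} γ≉ε (suc n) with small-fixed γ≉ε n
    ... | C , C≤ , ⊆C with far γ (size C)
    ...   | δ , δ≥ , δγ≥ = agree (code δ) (code (δ ∙ γ)) C ,
            ℚ.≤-trans (measure-agree C δ≥ δγ≥ λ eq →
                γ≉ε (identityʳ-unique δ γ (symᴳ (code-injective eq))))
              (ℚ.*-monoˡ-≤-nonNeg ½ C≤) ,
            λ {y} fixed → ∈-agree (code δ) (code (δ ∙ γ)) C {y} (sym (fixed δ)) (⊆C {y} fixed)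

    small-nonfree : ∀ {δ} → 0ℚ ℚ.< δ → Small δ (λ y → ¬ FreeSequence y)
    small-nonfree {δ} δ>0 = small-⊆ (λ {y} → nonfree⇒fixed {y}) ℚ.≤-refl (small-⋃ (ℚ.<⇒≤ δ>0) small)
      where
      FixedBy : ℕ → Pred Sequence g
      FixedBy i y = ∃[ γ ] code γ ≡ i × γ ≉ᴳ ε × γ ·ˢ config y ≈ˣ config y

      nonfree⇒fixed : ∀ {y} → ¬ FreeSequence y → ∃[ i ] FixedBy i y
      nonfree⇒fixed {y} ¬free = decidable-stable em-g λ none →
        ¬free λ γ fixed → decidable-stable em-g λ γ≉ε → none (code γ , γ , refl , γ≉ε , fixed)

      small : ∀ i → Small (½^ suc i ℚ.* δ) (FixedBy i)
      small i with em-g {∃[ γ ] code γ ≡ i × γ ≉ᴳ ε}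
      ... | no none = small-∅ (ℚ.<⇒≤ (scale-positive (suc i) δ>0))
              λ (γ , eq , γ≉ε , _) → none (γ , eq , γ≉ε)
      ... | yes (γ , refl , γ≉ε) =
            let n , n≤                = ½^-archimedean (scale-positive (suc (code γ)) δ>0)
                C , C≤ , fixed⇒∈C = small-fixed γ≉ε n
            in small-∈ᶜ C (ℚ.≤-trans C≤ n≤) λ {y} (γ′ , eq , _ , fixed) →
                 fixed⇒∈C {y} λ η → trans (Func.cong (config y) (∙-congˡ (symᴳ (code-injective eq)))) (fixed η)

  -- Finite groups: null sets are empty

  module _ {n} (bounded : ∀ γ → code γ ℕ.< n) where

    lookup-injective : ∀ {γs} → AllPairs _≉ᴳ_ γs → ∀ i j →
      List.lookup γs i ≈ᴳ List.lookup γs j → i ≡ j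
    lookup-injective (≉ ∷ ≉s) zero    zero    eq = refl
    lookup-injective (≉ ∷ ≉s) zero    (suc j) eq = contradiction eq (All.lookup ≉ (∈-lookup j))
    lookup-injective (≉ ∷ ≉s) (suc i) zero    eq = contradiction (symᴳ eq) (All.lookup ≉ (∈-lookup i))
    lookup-injective (≉ ∷ ≉s) (suc i) (suc j) eq = cong suc (lookup-injective ≉s i j eq)

    distinct-length : ∀ {γs} → AllPairs _≉ᴳ_ γs → length γs ℕ.≤ n
    distinct-length {γs} distinct = Fin.injective⇒≤ {f = λ i → fromℕ< (bounded (List.lookup γs i))}
      λ {i} {j} eq → lookup-injective distinct i j
        (code-injective (Fin.fromℕ<-injective _ _ (bounded _) (bounded _) eq))

    ½^≤mass : ∀ C → ½^ n ℚ.≤ mass C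
    ½^≤mass C = subst (½^ n ℚ.≤_) (sym (mass≡½^ C)) (½^-antitone
      (subst (ℕ._≤ n) (List.length-map proj₁ (Cylinder.constraints C)) (distinct-length (Cylinder.distinct C))))

    -- A cylinder constrains at most `n` distinct elements and so has mass at least `½^ n`; a cover
    -- of total mass below `½^ n` contains no cylinder.
    null⇒empty : ∀ {M} → βFree M ≤ᴿ fromℚ 0ℚ → ∀ {x} → ¬ x ∈ M
    null⇒empty null {x , free} x∈M with null (½^-positive n)
    ... | (C , cov) , r , r<½^n , sum<r with cov (free , x∈M)
    ...   | i , x∈ with C i in eq
    ...     | just c = ℚ.<-irrefl refl (begin-strict
      ½^ n                             ≤⟨ ½^≤mass c ⟩
      mass c                           ≡⟨ ℚ.+-identityˡ (mass c) ⟨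
      0ℚ ℚ.+ mass c
        ≤⟨ ℚ.+-monoˡ-≤ (mass c) (ℚ.≤-trans (measure-nonNeg (⋃-cylinders C i)) (⋃-cylinders-measure C i)) ⟩
      partialSum term i ℚ.+ mass c     ≡⟨ cong (λ c → partialSum term i ℚ.+ maybe′ mass 0ℚ c) eq ⟨
      partialSum term (suc i)          <⟨ sum<r (suc i) ⟩
      r                                <⟨ r<½^n ⟩
      ½^ n                             ∎)
      where
      open ℚ.≤-Reasoning
      term : ℕ → ℚ
      term i = maybe′ mass 0ℚ (C i)

-- Coding of pairs and the color arithmetic of one greedy step

pair-injective : ∀ m .{{_ : NonZero m}} {a a′ n n′} → a ℕ.< m → a′ ℕ.< m →
  a ℕ.+ n ℕ.* m ≡ a′ ℕ.+ n′ ℕ.* m → a ≡ a′ × n ≡ n′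
pair-injective m {a} {a′} {n} {n′} a<m a′<m eq = a≡a′ ,
  ℕ.*-cancelʳ-≡ n n′ m (ℕ.+-cancelˡ-≡ a _ _ (trans eq (cong (ℕ._+ n′ ℕ.* m) (sym a≡a′))))
  where
  remainder : ∀ {a n} → a ℕ.< m → (a ℕ.+ n ℕ.* m) ℕ.% m ≡ a
  remainder {a} {n} a<m = trans (ℕ.[m+kn]%n≡m%n a n m) (ℕ.m<n⇒m%n≡m a<m)
  a≡a′ : a ≡ a′
  a≡a′ = trans (sym (remainder {n = n} a<m)) (trans (cong (ℕ._% m) eq) (remainder {n = n′} a′<m))

-- The forbidden colors `a` and `b` are those of `γ · x` and `γ ⁻¹ · x`. Three nonzero colors
-- therefore suffice, and 0 is reserved.
fresh : ∀ a b → ∃[ c ] c ≢ a × c ≢ b × c ≢ 0 × c ℕ.< 4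
fresh a b with a ℕ.≟ 1 | b ℕ.≟ 1 | a ℕ.≟ 2 | b ℕ.≟ 2
... | no a≢1   | no b≢1   | _        | _        = 1 , a≢1 ∘ sym , b≢1 ∘ sym , (λ ()) , s≤s (s≤s z≤n)
... | _        | _        | no a≢2   | no b≢2   = 2 , a≢2 ∘ sym , b≢2 ∘ sym , (λ ()) , s≤s (s≤s (s≤s z≤n))
... | no _     | yes refl | no _     | yes ()
... | yes refl | no _     | yes ()   | no _
... | yes refl | _        | _        | yes refl = 3 , (λ ()) , (λ ()) , (λ ()) , s≤s (s≤s (s≤s (s≤s z≤n)))
... | _        | yes refl | yes refl | _        = 3 , (λ ()) , (λ ()) , (λ ()) , s≤s (s≤s (s≤s (s≤s z≤n)))

mex : ℕ → ℕ → ℕ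
mex a b = proj₁ (fresh a b)

mex≢ˡ : ∀ a b → mex a b ≢ a
mex≢ˡ a b = proj₁ (proj₂ (fresh a b))

mex≢ʳ : ∀ a b → mex a b ≢ b
mex≢ʳ a b = proj₁ (proj₂ (proj₂ (fresh a b)))

mex≢0 : ∀ a b → mex a b ≢ 0
mex≢0 a b = proj₁ (proj₂ (proj₂ (proj₂ (fresh a b))))

mex<4 : ∀ a b → mex a b ℕ.< 4
mex<4 a b = proj₂ (proj₂ (proj₂ (proj₂ (fresh a b))))

-- The color 0 stands for an uncolored point.
extend guard : ℕ → ℕ → ℕ
extend zero    c = c
extend (suc d) _ = suc d
guard zero    _ = 0
guard (suc _) c = c

extend< : ∀ {a b n} → a ℕ.< n → b ℕ.< n → extend a b ℕ.< n
extend< {zero}  a<n b<n = b<n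
extend< {suc _} a<n b<n = a<n

guard< : ∀ a {b n} → b ℕ.< n → guard a b ℕ.< n
guard< zero    b<n = ℕ.≤-<-trans z≤n b<n
guard< (suc _) b<n = b<n

extend-nonzero : ∀ {a b} → a ≢ 0 → extend a b ≡ a
extend-nonzero {zero}  a≢0 = contradiction refl a≢0
extend-nonzero {suc _} a≢0 = refl

-- Here `s` and `t` are the old colors of `x` and `γ · x`, `c` and `d` tell whether these points lie
-- in the current set, and `m` and `m′` are the colors offered to them. Since each offer only avoids
-- old colors, the two points must not be colored in the same step; independence of the current set
-- excludes this.
greedy-step : ∀ s t c d {m m′} → (s ≢ 0 → s ≢ t) → m ≢ t → m′ ≢ s → ¬ (c ≢ 0 × d ≢ 0) →
  extend s (guard c m) ≢ 0 → extend s (guard c m) ≢ extend t (guard d m′)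
greedy-step (suc s) (suc t) c d             s≢t m≢t m′≢s ¬both ≢0 = s≢t λ ()
greedy-step (suc s) zero    c zero          s≢t m≢t m′≢s ¬both ≢0 = λ ()
greedy-step (suc s) zero    c (suc d)       s≢t m≢t m′≢s ¬both ≢0 = m′≢s ∘ sym
greedy-step zero    t       zero d          s≢t m≢t m′≢s ¬both ≢0 = contradiction refl ≢0
greedy-step zero    (suc t) (suc c) d       s≢t m≢t m′≢s ¬both ≢0 = m≢t
greedy-step zero    zero    (suc c) zero    s≢t m≢t m′≢s ¬both ≢0 = ≢0
greedy-step zero    zero    (suc c) (suc d) s≢t m≢t m′≢s ¬both ≢0 =
  contradiction ((λ ()) , λ ()) ¬both

-- Borel colorings of the free part

module Colorings {g} (em : ExcludedMiddle (lsuc g)) (Γ : Group g g)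
  (countable : Countable (Group.setoid Γ)) where

  open Coding em Γ countable
  open Action (freeAction shift) using (_·_; ·-cong; ·-id; ·-assoc)
  open Setoid Free using ()
    renaming (Carrier to Point; _≈_ to _≈ᶠ_; refl to reflᶠ; sym to symᶠ; trans to transᶠ)

  borel-∪ : ∀ {A B} → BorelFree A → BorelFree B → BorelFree (A ∪ B)
  borel-∪ {A} {B} a b = resp (from , λ { (inj₁ x∈A) → 0 , x∈A ; (inj₂ x∈B) → 1 , x∈B }) (union borel)
    where
    family : ℕ → Pred Point g
    family zero    = A
    family (suc _) = B
    borel : ∀ n → BorelFree (family n)
    borel zero    = a
    borel (suc _) = b
    from : ⋃ ℕ family ⊆ A ∪ B
    from (zero  , x∈A) = inj₁ x∈A
    from (suc _ , x∈B) = inj₂ x∈B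

  borel-∩ : ∀ {A B} → BorelFree A → BorelFree B → BorelFree (A ∩ B)
  borel-∩ {A} {B} a b = resp
    ( (λ ¬∪ → decidable-stable em-g (¬∪ ∘ inj₁) , decidable-stable em-g (¬∪ ∘ inj₂))
    , λ { (x∈A , _) (inj₁ x∉A) → x∉A x∈A ; (_ , x∈B) (inj₂ x∉B) → x∉B x∈B } )
    (complement (borel-∪ (complement a) (complement b)))

  borel-full : BorelFree (λ _ → Lift g ⊤)
  borel-full = resp ((λ _ → lift tt) , λ {x} _ → excluded {x}) (borel-∪ a (complement a))
    where
    A : Pred Point g
    A x = Lift g (proj₁ x ⟨$⟩ ε ≡ true)
    a : BorelFree A
    a = generator ε (lower , lift)
    excluded : ∀ {x} → x ∈ A ∪ ∁ A
    excluded {x} with em-g {A x}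
    ... | yes x∈A = inj₁ x∈A
    ... | no x∉A  = inj₂ x∉A

  borel-const : (P : Set g) → BorelFree (λ _ → P)
  borel-const P with em-g {P}
  ... | yes p = resp ((λ _ → p) , λ _ → lift tt) borel-full
  ... | no ¬p = resp ((λ ¬full → contradiction (lift tt) ¬full) , λ p → contradiction p ¬p)
                  (complement borel-full)

  borel-shift : ∀ γ {A} → BorelFree A → BorelFree (λ x → γ · x ∈ A)
  borel-shift γ (generator δ (A⊆ , ⊆A))   = generator (δ ∙ γ) (A⊆ , ⊆A)
  borel-shift γ (complement b)            = complement (borel-shift γ b)
  borel-shift γ (union b)                 = union λ n → borel-shift γ (b n)
  borel-shift γ (resp (A⊆B , B⊆A) b)      = resp (A⊆B , B⊆A) (borel-shift γ b)

  BorelMap : (Point → ℕ) → Set (lsuc g)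
  BorelMap f = ∀ i → BorelFree (λ x → Lift g (f x ≡ i))

  borel-preimage : ∀ {f} → BorelMap f → (Q : ℕ → Set g) → BorelFree (λ x → Q (f x))
  borel-preimage bf Q = resp
    ((λ { (_ , lift refl , q) → q }) , λ q → _ , lift refl , q)
    (union λ i → borel-∩ (bf i) (borel-const (Q i)))

  borel-preimage₂ : ∀ {f h} → BorelMap f → BorelMap h → (Q : ℕ → ℕ → Set g) →
    BorelFree (λ x → Q (f x) (h x))
  borel-preimage₂ bf bh Q = resp
    ((λ { (_ , lift refl , q) → q }) , λ q → _ , lift refl , q)
    (union λ i → borel-∩ (bf i) (borel-preimage bh (Q i)))

  borelMap₂ : ∀ {f h} → BorelMap f → BorelMap h → (op : ℕ → ℕ → ℕ) → BorelMap (λ x → op (f x) (h x))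
  borelMap₂ bf bh op i = borel-preimage₂ bf bh λ m n → Lift g (op m n ≡ i)

  borelMap-shift : ∀ γ {f} → BorelMap f → BorelMap (λ x → f (γ · x))
  borelMap-shift γ bf i = borel-shift γ (bf i)

  toBit : Bool → ℕ
  toBit b = if b then 1 else 0

  toBit<2 : ∀ b → toBit b ℕ.< 2
  toBit<2 false = s≤s z≤n
  toBit<2 true  = s≤s (s≤s z≤n)

  toBit-injective : ∀ {b c} → toBit b ≡ toBit c → b ≡ c
  toBit-injective {false} {false} _ = refl
  toBit-injective {true}  {true}  _ = refl

  characteristic : Pred Point g → Point → ℕ
  characteristic A x with em-g {A x}
  ... | yes _ = 1
  ... | no _  = 0

  characteristic-cong : ∀ {A x y} → (A x → A y) → (A y → A x) → characteristic A x ≡ characteristic A y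
  characteristic-cong {A} {x} {y} to from with em-g {A x} | em-g {A y}
  ... | yes _ | yes _ = refl
  ... | yes a | no ¬a = contradiction (to a) ¬a
  ... | no ¬a | yes a = contradiction (from a) ¬a
  ... | no _  | no _  = refl

  characteristic-borel : ∀ {A} → BorelFree A → BorelMap (characteristic A)
  characteristic-borel {A} a i = resp (to , from)
    (borel-∪ (borel-∩ a (borel-const (Lift g (1 ≡ i)))) (borel-∩ (complement a) (borel-const (Lift g (0 ≡ i)))))
    where
    Level-set : Pred Point g
    Level-set x = Lift g (characteristic A x ≡ i)
    to : (A ∩ (λ _ → Lift g (1 ≡ i))) ∪ (∁ A ∩ (λ _ → Lift g (0 ≡ i))) ⊆ Level-set
    to {x} p with em-g {A x} | p
    ... | yes _ | inj₁ (_ , eq)   = eq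
    ... | yes q | inj₂ (¬q , _)   = contradiction q ¬q
    ... | no ¬q | inj₁ (q , _)    = contradiction q ¬q
    ... | no _  | inj₂ (_ , eq)   = eq
    from : Level-set ⊆ (A ∩ (λ _ → Lift g (1 ≡ i))) ∪ (∁ A ∩ (λ _ → Lift g (0 ≡ i)))
    from {x} eq with em-g {A x}
    ... | yes q = inj₁ (q , eq)
    ... | no ¬q = inj₂ (¬q , eq)

  -- A proper coloring of the graph joining `x` to `γ · x` for `γ` in `R`. The conclusion `γ ≈ᴳ ε`
  -- of `separates` allows `R` to contain the identity, as the quotients of a window may.
  record Coloring (R : Pred Carrier g) : Set (lsuc g) where
    field
      color       : Point → ℕ
      bound       : ℕ
      color<bound : ∀ x → color x ℕ.< bound
      color-cong  : ∀ {x y} → x ≈ᶠ y → color x ≡ color y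
      color-borel : BorelMap color
      separates   : ∀ {γ} → R γ → ∀ x → color x ≡ color (γ · x) → γ ≈ᴳ ε

  open Coloring public

  -- Greedy coloring along countably many Borel sets, each of which is
  -- disjoint from its translate by γ.
  module _ {γ} (γ≉ε : γ ≉ᴳ ε) where

    -- The number `k` codes a coordinate `δ` and a bit `b`. At `δ`, the point `x` has bit `b` and
    -- `γ · x` has bit `not b`, so the two are never in the same set. Every free point lies in some
    -- set because `γ` moves it.
    Switch : ℕ → Pred Point g
    Switch k (x , _) = ∃[ δ ] ∃[ b ]
      toBit b ℕ.+ code δ ℕ.* 2 ≡ k × x ⟨$⟩ δ ≡ b × x ⟨$⟩ (δ ∙ γ) ≡ not b

    switch-independent : ∀ k x → x ∈ Switch k → ¬ γ · x ∈ Switch k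
    switch-independent k (x , _) (δ , b , refl , _ , xδγ) (δ′ , b′ , eq , x′δ′ , _) =
      Bool.not-¬ refl (trans b≡b′ (trans (sym x′δ′)
        (trans (Func.cong x (∙-congʳ (code-injective (proj₂ codes)))) xδγ)))
      where
      codes : toBit b′ ≡ toBit b × code δ′ ≡ code δ
      codes = pair-injective 2 (toBit<2 b′) (toBit<2 b) eq
      b≡b′ : b ≡ b′
      b≡b′ = sym (toBit-injective (proj₁ codes))

    switch-covers : ∀ x → ∃[ k ] x ∈ Switch k
    switch-covers (x , free) with em-g {∃[ δ ] x ⟨$⟩ (δ ∙ γ) ≢ x ⟨$⟩ δ}
    ... | yes (δ , neq) = _ , δ , _ , refl , refl , Bool.¬-not neq
    ... | no none = contradiction
      (free γ λ δ → decidable-stable (_ Bool.≟ _) λ neq → none (δ , neq)) γ≉ε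

    switch-resp : ∀ k {x y} → x ≈ᶠ y → x ∈ Switch k → y ∈ Switch k
    switch-resp k x≈y (δ , b , eq , xδ , xδγ) =
      δ , b , eq , trans (sym (x≈y δ)) xδ , trans (sym (x≈y (δ ∙ γ))) xδγ

    borel-coordinate : ∀ δ b → BorelFree (λ (x , _) → Lift g (x ⟨$⟩ δ ≡ b))
    borel-coordinate δ true  = generator δ (lower , lift)
    borel-coordinate δ false = resp
      ((λ neq → lift (Bool.¬-not (neq ∘ lift))) , λ (lift eq) (lift eq′) → case trans (sym eq) eq′ of λ ())
      (complement (borel-coordinate δ true))

    switch-borel : ∀ k → BorelFree (Switch k)
    switch-borel k with em-g {∃[ δ ] ∃[ b ] toBit b ℕ.+ code δ ℕ.* 2 ≡ k}
    ... | no none = resp ((λ ()) , λ (δ , b , eq , _) → contradiction (δ , b , eq) none) (borel-const ⊥ₚ)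
    ... | yes (δ , b , refl) = resp
      ( (λ (lift xδ , lift xδγ) → δ , b , refl , xδ , xδγ)
      , λ {(x , _)} (δ′ , b′ , eq , xδ′ , xδ′γ) →
          let b′≡ , δ′≡ = pair-injective 2 (toBit<2 b′) (toBit<2 b) eq
              b′≡b      = toBit-injective b′≡
              δ≈δ′      = code-injective (sym δ′≡)
          in lift (trans (Func.cong x δ≈δ′) (trans xδ′ b′≡b)) ,
             lift (trans (Func.cong x (∙-congʳ δ≈δ′)) (trans xδ′γ (cong not b′≡b))) )
      (borel-∩ (borel-coordinate δ b) (borel-coordinate (δ ∙ γ) (not b)))

    stage : ℕ → Point → ℕ
    stage zero    x = 0
    stage (suc k) x = extend (stage k x)
      (guard (characteristic (Switch k) x) (mex (stage k (γ · x)) (stage k (γ ⁻¹ · x))))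

    stage-borel : ∀ k → BorelMap (stage k)
    stage-borel zero    i = borel-const (Lift g (0 ≡ i))
    stage-borel (suc k) = borelMap₂ (stage-borel k)
      (borelMap₂ (characteristic-borel (switch-borel k))
        (borelMap₂ (borelMap-shift γ (stage-borel k)) (borelMap-shift (γ ⁻¹) (stage-borel k)) mex)
        guard)
      extend

    stage-cong : ∀ k {x y} → x ≈ᶠ y → stage k x ≡ stage k y
    stage-cong zero    x≈y = refl
    stage-cong (suc k) {x} {y} x≈y = cong₂ extend (stage-cong k x≈y)
      (cong₂ guard (characteristic-cong (switch-resp k {x} {y} x≈y) (switch-resp k {y} {x} (symᶠ {x} {y} x≈y)))
        (cong₂ mex (stage-cong k (·-cong {x = x} {y} reflᴳ x≈y)) (stage-cong k (·-cong {x = x} {y} reflᴳ x≈y))))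

    stage<4 : ∀ k x → stage k x ℕ.< 4
    stage<4 zero    x = s≤s z≤n
    stage<4 (suc k) x = extend< (stage<4 k x) (guard< (characteristic (Switch k) x)
      (mex<4 (stage k (γ · x)) (stage k (γ ⁻¹ · x))))

    stage-stable : ∀ {j k} x → j ℕ.≤ k → stage j x ≢ 0 → stage k x ≡ stage j x
    stage-stable x j≤k ≢0 = go (ℕ.≤⇒≤′ j≤k) ≢0
      where
      go : ∀ {j k} → j ℕ.≤′ k → stage j x ≢ 0 → stage k x ≡ stage j x
      go ℕ.≤′-refl        ≢0 = refl
      go (ℕ.≤′-step j≤′k) ≢0 =
        trans (extend-nonzero λ eq → ≢0 (trans (sym (go j≤′k ≢0)) eq)) (go j≤′k ≢0)

    stage-switch : ∀ k x → x ∈ Switch k → stage (suc k) x ≢ 0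
    stage-switch k x x∈ with stage k x | em-g {Switch k x}
    ... | suc _ | _     = λ ()
    ... | zero  | yes _ = mex≢0 (stage k (γ · x)) (stage k (γ ⁻¹ · x))
    ... | zero  | no x∉ = contradiction x∈ x∉

    stage-proper : ∀ k x → stage k x ≢ 0 → stage k x ≢ stage k (γ · x)
    stage-proper zero    x ≢0 _ = ≢0 refl
    stage-proper (suc k) x = greedy-step (stage k x) (stage k (γ · x))
      (characteristic (Switch k) x) (characteristic (Switch k) (γ · x))
      (stage-proper k x) (mex≢ˡ (stage k (γ · x)) (stage k (γ ⁻¹ · x)))
      (λ eq → mex≢ʳ (stage k (γ · γ · x)) (stage k (γ ⁻¹ · γ · x))
        (trans eq (stage-cong k {x} {γ ⁻¹ · γ · x} back)))
      λ { (c≢0 , d≢0) → switch-independent k x (nonzero⇒∈ c≢0) (nonzero⇒∈ {x = γ · x} d≢0) }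
      where
      back : x ≈ᶠ γ ⁻¹ · γ · x
      back = transᶠ {x} {ε · x} {γ ⁻¹ · γ · x} (symᶠ {ε · x} {x} (·-id x))
        (transᶠ {ε · x} {(γ ⁻¹ ∙ γ) · x} {γ ⁻¹ · γ · x}
          (·-cong {x = x} {x} (symᴳ (inverseˡ γ)) (reflᶠ {x})) (·-assoc (γ ⁻¹) γ x))
      nonzero⇒∈ : ∀ {A x} → characteristic A x ≢ 0 → x ∈ A
      nonzero⇒∈ {A} {x} ≢0 with em-g {A x}
      ... | yes x∈A = x∈A
      ... | no _    = contradiction refl ≢0

    index : Point → ℕ
    index x = suc (proj₁ (switch-covers x))

    index-colored : ∀ x → stage (index x) x ≢ 0
    index-colored x = stage-switch _ x (proj₂ (switch-covers x))

    greedy : Point → ℕ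
    greedy x = stage (index x) x

    -- A colored point keeps its color. Hence `greedy` does not depend on the stage picked by
    -- `index`, which rests on a choice not known to be Borel or to respect equality of points.
    greedy-stage : ∀ k x → stage k x ≢ 0 → greedy x ≡ stage k x
    greedy-stage k x ≢0 with ℕ.≤-total (index x) k
    ... | inj₁ i≤k = sym (stage-stable x i≤k (index-colored x))
    ... | inj₂ k≤i = stage-stable x k≤i ≢0

    later-colored : ∀ x {k} → index x ℕ.≤ k → stage k x ≢ 0
    later-colored x i≤k eq = index-colored x (trans (sym (stage-stable x i≤k (index-colored x))) eq)

    greedyColoring : Coloring (_≈ᴳ γ)
    greedyColoring = record
      { color       = greedy
      ; bound       = 4
      ; color<bound = λ x → stage<4 (index x) x
      ; color-cong  = λ {x} {y} x≈y → trans (stage-cong (index x) {x} {y} x≈y)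
          (sym (greedy-stage (index x) y λ eq → index-colored x (trans (stage-cong (index x) {x} {y} x≈y) eq)))
      ; color-borel = λ i → resp
          ( (λ { {x} (k , lift eq , lift i≢0) → lift (trans (greedy-stage k x (i≢0 ∘ trans (sym eq))) eq) })
          , λ { {x} (lift refl) → index x , lift refl , lift (index-colored x) } )
          (union λ k → borel-∩ (stage-borel k i) (borel-const (Lift g (i ≢ 0))))
      ; separates   = λ {δ} δ≈γ x eq → contradiction (trans eq (cong-shift δ≈γ x)) (proper x)
      }
      where
      proper : ∀ x → greedy x ≢ greedy (γ · x)
      proper x eq = stage-proper k x (later-colored x (ℕ.m≤m+n (index x) (index (γ · x))))
        (trans (sym (greedy-stage k x (later-colored x (ℕ.m≤m+n (index x) (index (γ · x))))))
          (trans eq (greedy-stage k (γ · x) (later-colored (γ · x) (ℕ.m≤n+m (index (γ · x)) (index x))))))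
        where
        k : ℕ
        k = index x ℕ.+ index (γ · x)
      cong-shift : ∀ {δ} → δ ≈ᴳ γ → ∀ x → greedy (δ · x) ≡ greedy (γ · x)
      cong-shift {δ} δ≈γ x = trans
        (stage-cong (index (δ · x)) {δ · x} {γ · x} δx≈γx)
        (sym (greedy-stage (index (δ · x)) (γ · x) λ eq → index-colored (δ · x)
          (trans (stage-cong (index (δ · x)) {δ · x} {γ · x} δx≈γx) eq)))
        where
        δx≈γx : δ · x ≈ᶠ γ · x
        δx≈γx = ·-cong {x = x} {x} δ≈γ (reflᶠ {x})

  coloring-trivial : ∀ {R : Pred Carrier g} → (∀ {γ} → R γ → γ ≈ᴳ ε) → Coloring R
  coloring-trivial R⇒ε = record
    { color       = λ _ → 0
    ; bound       = 1
    ; color<bound = λ _ → s≤s z≤n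
    ; color-cong  = λ _ → refl
    ; color-borel = λ i → borel-const (Lift g (0 ≡ i))
    ; separates   = λ r _ _ → R⇒ε r
    }

  coloring-∪ : ∀ {R S} → Coloring R → Coloring S → Coloring (R ∪ S)
  coloring-∪ c d = record
    { color       = combine
    ; bound       = bound c ℕ.+ bound d ℕ.* suc (bound c)
    ; color<bound = λ x → ℕ.+-mono-<-≤ (color<bound c x) (ℕ.*-monoˡ-≤ (suc (bound c)) (ℕ.<⇒≤ (color<bound d x)))
    ; color-cong  = λ {x} {y} x≈y → cong₂ pair (color-cong c {x} {y} x≈y) (color-cong d {x} {y} x≈y)
    ; color-borel = borelMap₂ (color-borel c) (color-borel d) pair
    ; separates   = λ
        { (inj₁ r) x eq → separates c r x (proj₁ (split x eq))
        ; (inj₂ s) x eq → separates d s x (proj₂ (split x eq)) }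
    }
    where
    pair : ℕ → ℕ → ℕ
    -- The base is `suc (bound c)` because decoding divides by it and so needs it to be visibly
    -- nonzero.
    pair a b = a ℕ.+ b ℕ.* suc (bound c)
    combine : Point → ℕ
    combine x = pair (color c x) (color d x)
    split : ∀ {γ} x → combine x ≡ combine (γ · x) →
      color c x ≡ color c (γ · x) × color d x ≡ color d (γ · x)
    split {γ} x eq = pair-injective (suc (bound c))
      (ℕ.m<n⇒m<1+n (color<bound c x)) (ℕ.m<n⇒m<1+n (color<bound c (γ · x))) eq

  coloring-⊆ : ∀ {R S} → R ⊆ S → Coloring S → Coloring R
  coloring-⊆ R⊆S c = record
    { color       = color c
    ; bound       = bound c
    ; color<bound = color<bound c
    ; color-cong  = λ {x} {y} → color-cong c {x} {y}
    ; color-borel = color-borel c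
    ; separates   = λ r → separates c (R⊆S r)
    }

  coloring-≈ : ∀ γ → Coloring (_≈ᴳ γ)
  coloring-≈ γ with em-g {γ ≈ᴳ ε}
  ... | yes γ≈ε = coloring-trivial λ δ≈γ → transᴳ δ≈γ γ≈ε
  ... | no γ≉ε  = greedyColoring γ≉ε

  coloring-⋃ : {R : ℕ → Pred Carrier g} → (∀ i → Coloring (R i)) →
    ∀ n → Coloring (λ γ → ∃[ i ] i ℕ.< n × R i γ)
  coloring-⋃ c zero    = coloring-trivial λ ()
  coloring-⋃ {R} c (suc n) = coloring-⊆ split (coloring-∪ (coloring-⋃ c n) (c n))
    where
    split : (λ γ → ∃[ i ] i ℕ.< suc n × R i γ) ⊆ (λ γ → ∃[ i ] i ℕ.< n × R i γ) ∪ R n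
    split (i , i<1+n , r) with ℕ.m≤n⇒m<n∨m≡n (s≤s⁻¹ i<1+n)
    ... | inj₁ i<n  = inj₁ (i , i<n , r)
    ... | inj₂ refl = inj₂ r

  -- `δ ∙ η ⁻¹` carries `η · x` to `δ · x`, so separating all quotients of a window makes a coloring
  -- injective on the window's translates of each point.
  Quotient : ℕ → ℕ → Pred Carrier g
  Quotient i j γ = ∃[ δ ] ∃[ η ] code δ ≡ i × code η ≡ j × γ ≈ᴳ δ ∙ η ⁻¹

  quotientColoring : ∀ i j → Coloring (Quotient i j)
  quotientColoring i j with em-g {∃[ γ ] Quotient i j γ}
  ... | no none = coloring-trivial λ r → contradiction (_ , r) none
  ... | yes (γ , δ , η , refl , refl , γ≈) = coloring-⊆
    (λ (δ′ , η′ , eqδ , eqη , γ′≈) → transᴳ γ′≈ (∙-cong (code-injective eqδ) (⁻¹-cong (code-injective eqη))))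
    (coloring-≈ (δ ∙ η ⁻¹))

  windowColoring : ∀ n → Coloring (λ γ → ∃[ i ] i ℕ.< n × (∃[ j ] j ℕ.< n × Quotient i j γ))
  windowColoring n = coloring-⋃ (λ i → coloring-⋃ (quotientColoring i) n) n

-- Counting labellings and listing the sets of a multiple cover

count : ℕ → (Sequence → Bool) → ℕ
count zero    ψ = if ψ (λ _ → false) then 1 else 0
count (suc d) ψ = count d (ψ ∘ (false ◂_)) ℕ.+ count d (ψ ∘ (true ◂_))

μ-count : ∀ d ψ → μ d ψ ℚ.* fromℕ (2 ℕ.^ d) ≡ fromℕ (count d ψ)
μ-count zero ψ with ψ (λ _ → false)
... | true  = ℚ.*-identityˡ (fromℕ 1)
... | false = trans (ℚ.*-zeroˡ (fromℕ 1)) (sym fromℕ-0)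
μ-count (suc d) ψ = begin
  avg p q ℚ.* fromℕ (2 ℕ.^ suc d)          ≡⟨ cong (avg p q ℚ.*_) double ⟩
  avg p q ℚ.* (c ℚ.+ c)                    ≡⟨ avg-*ʳ p q (c ℚ.+ c) ⟩
  ½ ℚ.* (p ℚ.* (c ℚ.+ c) ℚ.+ q ℚ.* (c ℚ.+ c))   ≡⟨ rearrange p q c ⟩
  p ℚ.* c ℚ.+ q ℚ.* c
    ≡⟨ cong₂ ℚ._+_ (μ-count d (ψ ∘ (false ◂_))) (μ-count d (ψ ∘ (true ◂_))) ⟩
  fromℕ (count d (ψ ∘ (false ◂_))) ℚ.+ fromℕ (count d (ψ ∘ (true ◂_)))
                                           ≡⟨ fromℕ-+ (count d (ψ ∘ (false ◂_))) (count d (ψ ∘ (true ◂_))) ⟨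
  fromℕ (count (suc d) ψ)                  ∎
  where
  open ≡-Reasoning
  p q c : ℚ
  p = μ d (ψ ∘ (false ◂_))
  q = μ d (ψ ∘ (true ◂_))
  c = fromℕ (2 ℕ.^ d)
  double : fromℕ (2 ℕ.^ suc d) ≡ c ℚ.+ c
  double = trans (fromℕ-+ (2 ℕ.^ d) (2 ℕ.^ d ℕ.+ 0))
    (cong (λ m → c ℚ.+ fromℕ m) (ℕ.+-identityʳ (2 ℕ.^ d)))
  rearrange : ∀ p q c → ½ ℚ.* (p ℚ.* (c ℚ.+ c) ℚ.+ q ℚ.* (c ℚ.+ c)) ≡ p ℚ.* c ℚ.+ q ℚ.* c
  rearrange = solve 3 (λ p q c →
    con ½ :* (p :* (c :+ c) :+ q :* (c :+ c)) := p :* c :+ q :* c) refl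
    where open +-*-Solver

module _ {n : ℕ} where

  familySize : ℕ → ℕ
  familySize zero    = n
  familySize (suc d) = familySize d ℕ.+ familySize d

  familySize≡ : ∀ d → familySize d ≡ n ℕ.* 2 ℕ.^ d
  familySize≡ zero    = sym (ℕ.*-identityʳ n)
  familySize≡ (suc d) = trans (cong₂ ℕ._+_ (familySize≡ d) (familySize≡ d))
    (trans (sym (ℕ.*-distribˡ-+ n (2 ℕ.^ d) (2 ℕ.^ d)))
      (cong (λ m → n ℕ.* (2 ℕ.^ d ℕ.+ m)) (sym (ℕ.+-identityʳ (2 ℕ.^ d)))))

  -- Lists the values of S at the sequences that vanish from index d on.
  family : ∀ {A : Set ℓ} d → (Sequence → Fin n → A) → Fin (familySize d) → A
  family zero    S   = S (λ _ → false)
  family (suc d) S i = Sum.[ family d (S ∘ (false ◂_)) , family d (S ∘ (true ◂_)) ]′ (splitAt (familySize d) i)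

  family-all : ∀ {A : Set ℓ} (P : A → Set ℓ′) d S → (∀ h j → P (S h j)) → ∀ i → P (family d S i)
  family-all P zero    S all i = all (λ _ → false) i
  family-all P (suc d) S all i with splitAt (familySize d) i
  ... | inj₁ i′ = family-all P d (S ∘ (false ◂_)) (all ∘ (false ◂_)) i′
  ... | inj₂ i′ = family-all P d (S ∘ (true ◂_)) (all ∘ (true ◂_)) i′

  ∣++∣ : ∀ {m m′} (p : Subset m) (q : Subset m′) → ∣ p Vec.++ q ∣ ≡ ∣ p ∣ ℕ.+ ∣ q ∣
  ∣++∣ []          q = refl
  ∣++∣ (true ∷ p)  q = cong suc (∣++∣ p q)
  ∣++∣ (false ∷ p) q = ∣++∣ p q

  -- Each `h` satisfying `ψ` contributes one index, taken from its own block of `n` consecutive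
  -- sets, so different `h` give different indices even when the sets coincide.
  family-select : ∀ {X : Set ℓ} (x : X) d (S : Sequence → Fin n → Pred X ℓ′) ψ →
    (∀ h → ψ h ≡ true → ∃[ j ] x ∈ S h j) →
    Σ[ J ∈ Subset (familySize d) ] count d ψ ℕ.≤ ∣ J ∣ × (∀ {i} → i ∈ˢ J → x ∈ family d S i)
  family-select x zero S ψ select with ψ (λ _ → false) in eq
  ... | false = ⊥ , z≤n , λ i∈⊥ → contradiction i∈⊥ Subset.∉⊥
  ... | true with select _ eq
  ...   | j , x∈ = ⁅ j ⁆ , ℕ.≤-reflexive (sym (Subset.∣⁅x⁆∣≡1 j)) ,
          λ i∈ → subst (λ i → x ∈ S _ i) (sym (Subset.x∈⁅y⁆⇒x≡y j i∈)) x∈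
  family-select x (suc d) S ψ select
    with family-select x d (S ∘ (false ◂_)) (ψ ∘ (false ◂_)) (select ∘ (false ◂_))
       | family-select x d (S ∘ (true ◂_)) (ψ ∘ (true ◂_)) (select ∘ (true ◂_))
  ... | J , ≤J , J⊆ | K , ≤K , K⊆ = J Vec.++ K ,
        ℕ.≤-trans (ℕ.+-mono-≤ ≤J ≤K) (ℕ.≤-reflexive (sym (∣++∣ J K))) , λ {i} i∈ →
          by-half i (trans (sym (Vec.lookup-splitAt (familySize d) J K i)) (Vec.[]=⇒lookup i∈))
    where
    by-half : ∀ i → Sum.[ Vec.lookup J , Vec.lookup K ]′ (splitAt (familySize d) i) ≡ true →
      x ∈ family (suc d) S i
    by-half i eq with splitAt (familySize d) i
    ... | inj₁ i′ = J⊆ (Vec.lookup⇒[]= i′ J eq)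
    ... | inj₂ i′ = K⊆ (Vec.lookup⇒[]= i′ K eq)

⋃ᶠ : ∀ {n} → (Fin n → Clopen) → Clopen
⋃ᶠ {zero}  C = ∅ᶜ
⋃ᶠ {suc n} C = C zero ∪ᶜ ⋃ᶠ (C ∘ suc)

∈-⋃ᶠ⁺ : ∀ {n} (C : Fin n → Clopen) j y → y ∈ᶜ C j → y ∈ᶜ ⋃ᶠ C
∈-⋃ᶠ⁺ C zero    y y∈ = ∈-∪ᶜ⁺ˡ (C zero) (⋃ᶠ (C ∘ suc)) {y} y∈
∈-⋃ᶠ⁺ C (suc j) y y∈ = ∈-∪ᶜ⁺ʳ (C zero) (⋃ᶠ (C ∘ suc)) {y} (∈-⋃ᶠ⁺ (C ∘ suc) j y y∈)

∈-⋃ᶠ⁻ : ∀ {n} (C : Fin n → Clopen) y → y ∈ᶜ ⋃ᶠ C → ∃[ j ] y ∈ᶜ C j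
∈-⋃ᶠ⁻ {suc n} C y y∈ with ∈-∪ᶜ⁻ (C zero) (⋃ᶠ (C ∘ suc)) {y} y∈
... | inj₁ y∈₀ = zero , y∈₀
... | inj₂ y∈ₛ with ∈-⋃ᶠ⁻ (C ∘ suc) y y∈ₛ
...   | j , y∈ⱼ = suc j , y∈ⱼ

least-≤ : (em : ExcludedMiddle ℓ) (P : Pred ℕ ℓ) → ∀ {n} → P n → ∃[ m ] least em P ≡ [ m ] × m ℕ.≤ n
least-≤ em P {n} Pn with leastWithProof em P
... | [ m ] , _ , min = m , refl , min n Pn
... | ⊤⁺ , none       = contradiction Pn (none n)

÷-< : ∀ {l k s n d q} → l ℕ.≤ s → s ≡ n ℕ.* d →
  fromℕ n ℚ.* fromℕ d ℚ.< fromℕ (suc k) ℚ.* q → + l / suc k ℚ.< q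
÷-< {l} {k} {s} {n} {d} {q} l≤s s≡nd lt = ℚ.*-cancelʳ-<-nonNeg (fromℕ (suc k))
  {{ℚ.nonNegative (ℚ.<⇒≤ (fromℕ-positive (suc k)))}} (begin-strict
    (+ l / suc k) ℚ.* fromℕ (suc k)   ≡⟨ /-*-cancel l (suc k) ⟩
    fromℕ l                           ≤⟨ fromℕ-mono-≤ l≤s ⟩
    fromℕ s                           ≡⟨ trans (cong fromℕ s≡nd) (fromℕ-* n d) ⟩
    fromℕ n ℚ.* fromℕ d               <⟨ lt ⟩
    fromℕ (suc k) ℚ.* q               ≡⟨ ℚ.*-comm (fromℕ (suc k)) q ⟩
    q ℚ.* fromℕ (suc k)               ∎)
  where open ℚ.≤-Reasoning

module _ {p q} (p≥0 : 0ℚ ℚ.≤ p) (p<q : p ℚ.< q) where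

  private
    q>0 : 0ℚ ℚ.< q
    q>0 = ℚ.≤-<-trans p≥0 p<q

    instance
      q-positive : ℚ.Positive q
      q-positive = ℚ.positive q>0
      q-nonZero : ℚ.NonZero q
      q-nonZero = ℚ.pos⇒nonZero q

    gap : ℚ
    gap = ½ ℚ.* (q ℚ.- p)

    gap>0 : 0ℚ ℚ.< gap
    gap>0 = half-positive (subst (ℚ._< q ℚ.- p) (ℚ.+-inverseʳ p) (ℚ.+-monoˡ-< (ℚ.- p) p<q))

    tolerance : ℚ
    tolerance = gap ℚ.* ℚ.1/ q

    tolerance-* : tolerance ℚ.* q ≡ gap
    tolerance-* = trans (ℚ.*-assoc gap (ℚ.1/ q) q)
      (trans (cong (gap ℚ.*_) (ℚ.*-inverseˡ q)) (ℚ.*-identityʳ gap))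

  -- Chosen as (q - p) / 2q.
  exists-tolerance : ∃[ δ ] 0ℚ ℚ.< δ × (∀ {m} → 1ℚ ℚ.≤ m ℚ.+ δ → p ℚ.< m ℚ.* q)
  exists-tolerance = tolerance ,
    ℚ.*-cancelʳ-<-nonNeg q {{ℚ.pos⇒nonNeg q}}
      (subst (ℚ._< tolerance ℚ.* q) (sym (ℚ.*-zeroˡ q)) (subst (0ℚ ℚ.<_) (sym tolerance-*) gap>0)) ,
    λ {m} 1≤m+δ → ℚ.≰⇒> λ mq≤p → ℚ.<-irrefl refl (begin-strict
      q                               ≡⟨ ℚ.*-identityˡ q ⟨
      1ℚ ℚ.* q                        ≤⟨ *-monoʳ-≤ (ℚ.<⇒≤ q>0) 1≤m+δ ⟩
      (m ℚ.+ tolerance) ℚ.* q         ≡⟨ ℚ.*-distribʳ-+ q m tolerance ⟩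
      m ℚ.* q ℚ.+ tolerance ℚ.* q     ≡⟨ cong (m ℚ.* q ℚ.+_) tolerance-* ⟩
      m ℚ.* q ℚ.+ gap                 ≤⟨ ℚ.+-monoˡ-≤ gap mq≤p ⟩
      p ℚ.+ gap                       ≡⟨ ℚ.+-identityʳ _ ⟨
      p ℚ.+ gap ℚ.+ 0ℚ                <⟨ ℚ.+-monoʳ-< (p ℚ.+ gap) gap>0 ⟩
      p ℚ.+ gap ℚ.+ gap               ≡⟨ refill p q ⟩
      q                               ∎)
    where
    open ℚ.≤-Reasoning
    refill : ∀ p q → p ℚ.+ ½ ℚ.* (q ℚ.+ ℚ.- p) ℚ.+ ½ ℚ.* (q ℚ.+ ℚ.- p) ≡ q
    refill = solve 2 (λ p q →
      p :+ con ½ :* (q :+ :- p) :+ con ½ :* (q :+ :- p) := q) refl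
      where open +-*-Solver

-- From measurable covers to Borel multiple covers

module Covers {g} (em : ExcludedMiddle (lsuc g)) (Γ : Group g g)
  (countable : Countable (Group.setoid Γ)) (F : List (Group.Carrier Γ)) where

  open Coding em Γ countable
  open Colorings em Γ countable
  open Action (freeAction shift) using (_·_; ·-cong; ·-id; ·-assoc)
  open Setoid Free using ()
    renaming (Carrier to Point; _≈_ to _≈ᶠ_; refl to reflᶠ; sym to symᶠ; trans to transᶠ)
  open SetoidMembership (Group.setoid Γ) using () renaming (_∈_ to _∈ᴸ_)

  G : Graph g
  G = schreier (freeAction shift) F

  open Graph G using (Adjacent; Independent)
  open Chromatic em G BorelFree

  F± : List Carrier
  F± = F ++ map _⁻¹ F

  -- `F±` may contain the identity, which gives no edges; without the first case `core C` would then
  -- be empty.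
  translateSet : Carrier → Clopen → Clopen
  translateSet σ C with em-g {σ ≈ᴳ ε}
  ... | yes _ = ∅ᶜ
  ... | no _  = preimage (translate σ) C

  moved : List Carrier → Clopen → Clopen
  moved []      C = ∅ᶜ
  moved (σ ∷ L) C = translateSet σ C ∪ᶜ moved L C

  translate-cong : ∀ {σ τ} → σ ≈ᴳ τ → ∀ i → translate σ i ≡ translate τ i
  translate-cong σ≈τ i with em-g {Coded i}
  ... | yes _ = code-cong (∙-congˡ σ≈τ)
  ... | no _  = refl

  ∈-translateSet⁺ : ∀ {σ τ} C y → σ ≉ᴳ ε → σ ≈ᴳ τ → y ∘ translate σ ∈ᶜ C → y ∈ᶜ translateSet τ C
  ∈-translateSet⁺ {σ} {τ} C y σ≉ε σ≈τ y∈ with em-g {τ ≈ᴳ ε}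
  ... | yes τ≈ε = contradiction (transᴳ σ≈τ τ≈ε) σ≉ε
  ... | no _    = ∈ᶜ-resp C (λ i → cong y (translate-cong σ≈τ i)) y∈

  ∈-moved⁺ : ∀ {σ} L C y → σ ≉ᴳ ε → σ ∈ᴸ L → y ∘ translate σ ∈ᶜ C → y ∈ᶜ moved L C
  ∈-moved⁺ (τ ∷ L) C y σ≉ε (here σ≈τ) y∈ =
    ∈-∪ᶜ⁺ˡ (translateSet τ C) (moved L C) {y} (∈-translateSet⁺ C y σ≉ε σ≈τ y∈)
  ∈-moved⁺ (τ ∷ L) C y σ≉ε (there σ∈) y∈ =
    ∈-∪ᶜ⁺ʳ (translateSet τ C) (moved L C) {y} (∈-moved⁺ L C y σ≉ε σ∈ y∈)

  ∈-moved⁻ : ∀ L C y → y ∈ᶜ moved L C → Any (λ σ → σ ≉ᴳ ε × y ∘ translate σ ∈ᶜ C) L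
  ∈-moved⁻ (σ ∷ L) C y y∈ with ∈-∪ᶜ⁻ (translateSet σ C) (moved L C) {y} y∈
  ... | inj₂ y∈moved = there (∈-moved⁻ L C y y∈moved)
  ... | inj₁ y∈σ with em-g {σ ≈ᴳ ε}
  ...   | no σ≉ε = here (σ≉ε , y∈σ)

  core : Clopen → Clopen
  core C = C ∖ᶜ moved F± C

  -- Translations preserve the measure, so `length L` + 1 sets of the same smallness are united;
  -- halving once per element of `L` suffices.
  small-translates : ∀ {δ} {U : Pred Sequence g} L → 0ℚ ℚ.< δ → Small (½^ length L ℚ.* δ) U →
    Small δ (U ∪ λ y → Any (λ σ → y ∘ translate σ ∈ U) L)
  small-translates {δ} [] δ>0 S =
    small-⊆ (λ { (inj₁ y∈) → y∈ }) (ℚ.≤-reflexive (ℚ.*-identityˡ δ)) S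
  small-translates {δ} {U} (σ ∷ L) δ>0 S = small-⊆ split (ℚ.≤-reflexive (half+half δ))
    (small-∪ {A = V} {B = λ y → y ∘ translate σ ∈ U}
      (small-translates {½ ℚ.* δ} {U} L (half-positive δ>0) (subst (λ δ → Small δ U) (scale-suc (length L) δ) S))
      (small-preimage (translate-injective σ)
        (small-⊆ (λ y∈ → y∈) (subst (ℚ._≤ ½ ℚ.* δ) (sym (scale-suc (length L) δ))
          (scale≤ (length L) (ℚ.<⇒≤ (half-positive δ>0)))) S)))
    where
    V : Pred Sequence g
    V = U ∪ λ y → Any (λ σ → y ∘ translate σ ∈ U) L
    split : (U ∪ λ y → Any (λ σ → y ∘ translate σ ∈ U) (σ ∷ L)) ⊆ V ∪ (λ y → y ∘ translate σ ∈ U)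
    split (inj₁ y∈)         = inj₁ (inj₁ y∈)
    split (inj₂ (here y∈))  = inj₂ y∈
    split (inj₂ (there y∈)) = inj₁ (inj₂ y∈)

  measurable⇒approximable : ∀ {A} → Measurable βFree A → Approximable (onSequences A)
  measurable⇒approximable {A} (_ , B , borelB , M , _ , (null , _) , Δ⊆M) {δ} δ>0 =
    proj₁ approx , small-⊆ split (ℚ.≤-reflexive (half+half δ))
      (small-∪ (proj₂ approx) (null⇒small {M} null (half-positive δ>0)))
    where
    approx : Σ[ C ∈ Clopen ] Small (½ ℚ.* δ) (Difference C (onSequences B))
    approx = borel⇒approximable borelB (half-positive δ>0)
    split : Difference (proj₁ approx) (onSequences A)
      ⊆ Difference (proj₁ approx) (onSequences B) ∪ (λ y → Σ[ free ∈ FreeSequence y ] (config y , free) ∈ M)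
    split {y} (free , inj₁ (y∈C , y∉A)) with em-g {(config y , free) ∈ B}
    ... | yes y∈B = inj₂ (free , Δ⊆M (inj₂ (y∈B , y∉A)))
    ... | no y∉B  = inj₁ (free , inj₁ (y∈C , y∉B))
    split {y} (free , inj₂ (y∉C , y∈A)) with em-g {(config y , free) ∈ B}
    ... | yes y∈B = inj₁ (free , inj₂ (y∉C , y∈B))
    ... | no y∉B  = inj₂ (free , Δ⊆M (inj₁ (y∈A , y∉B)))

  free-translate : ∀ {y} σ → FreeSequence y → FreeSequence (y ∘ translate σ)
  free-translate {y} σ free γ fixed = proj₂ (σ · (config y , free)) γ λ δ →
    trans (sym (config-translate σ y (δ ∙ γ))) (trans (fixed δ) (config-translate σ y δ))

  -- A point of `A` outside `C` is an error itself. If it is in `C` but was deleted, some nontrivial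
  -- `σ` moves it into `C`; its image is a neighbor, hence not in `A`, hence an error.
  uncovered⇒error : ∀ {A} → Independent A → ∀ C {y} (free : FreeSequence y) → (config y , free) ∈ A →
    ¬ y ∈ᶜ core C →
    y ∈ Difference C (onSequences A) ∪ (λ y → Any (λ σ → y ∘ translate σ ∈ Difference C (onSequences A)) F±)
  uncovered⇒error {A} independent C {y} free y∈A y∉core with ∈ᶜ? C y
  ... | inj₂ y∉C = inj₁ (free , inj₂ ((λ y∈C → case trans (sym y∈C) y∉C of λ ()) , y∈A))
  ... | inj₁ y∈C = inj₂ (lose σ∈ (free′ , inj₁ (σy∈C , σy∉A)))
    where
    y∈moved : y ∈ᶜ moved F± C
    y∈moved with ∈ᶜ? (moved F± C) y
    ... | inj₁ y∈ = y∈
    ... | inj₂ y∉ = contradiction (∈-∩ᶜ⁺ C (∁ᶜ (moved F± C)) {y} y∈C (cong not y∉)) y∉core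
    found : ∃[ σ ] σ ∈ᴾ F± × σ ≉ᴳ ε × y ∘ translate σ ∈ᶜ C
    found = find (∈-moved⁻ F± C y y∈moved)
    σ : Carrier
    σ = proj₁ found
    σ∈ : σ ∈ᴾ F±
    σ∈ = proj₁ (proj₂ found)
    σ≉ε : σ ≉ᴳ ε
    σ≉ε = proj₁ (proj₂ (proj₂ found))
    σy∈C : y ∘ translate σ ∈ᶜ C
    σy∈C = proj₂ (proj₂ (proj₂ found))
    free′ : FreeSequence (y ∘ translate σ)
    free′ = free-translate {y} σ free
    adjacent : Adjacent (config y , free) (config (y ∘ translate σ) , free′)
    adjacent = (λ same → σ≉ε (free σ λ γ → trans (sym (config-translate σ y γ)) (sym (same γ)))) ,
      σ , Any.map (λ { refl → reflᴳ }) σ∈ , config-translate σ y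
    σy∉A : ¬ (config (y ∘ translate σ) , free′) ∈ A
    σy∉A σy∈A = independent y∈A σy∈A adjacent

  module _ {n} (infinite : Infinite) (I : Fin n → Pred Point g)
    (measurable : ∀ j → Measurable βFree (I j)) (independent : ∀ j → Independent (I j))
    (covering : ∀ x → ∃[ j ] x ∈ I j) where

    clopenCover : ∀ {δ} → 0ℚ ℚ.< δ →
      Σ[ C ∈ (Fin n → Clopen) ] 1ℚ ℚ.≤ measure (⋃ᶠ (core ∘ C)) ℚ.+ δ
    clopenCover {δ} δ>0 = C , ℚ.≤-trans (measure-∁ good)
      (ℚ.+-monoʳ-≤ (measure good) (small-clopen em-0 (∁ᶜ good) bad-small))
      where
      error : Fin n → ℚ
      -- Half of `δ` is kept for the non-free sequences, the rest is divided geometrically among the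
      -- `j`. The further factor `½^ length F±` below pays for the translates.
      error j = ½^ suc (toℕ j) ℚ.* (½ ℚ.* δ)
      error>0 : ∀ j → 0ℚ ℚ.< error j
      error>0 j = scale-positive (suc (toℕ j)) (half-positive δ>0)
      approx : ∀ j → Σ[ C ∈ Clopen ] Small (½^ length F± ℚ.* error j) (Difference C (onSequences (I j)))
      approx j = measurable⇒approximable (measurable j) (scale-positive (length F±) (error>0 j))
      C : Fin n → Clopen
      C j = proj₁ (approx j)
      good : Clopen
      good = ⋃ᶠ (core ∘ C)

      Error : Fin n → Pred Sequence g
      Error j = Difference (C j) (onSequences (I j)) ∪
        λ y → Any (λ σ → y ∘ translate σ ∈ Difference (C j) (onSequences (I j))) F±
      ErrorAt : ℕ → Pred Sequence g
      ErrorAt i y = ∃[ j ] toℕ j ≡ i × y ∈ Error j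

      small-errorAt : ∀ i → Small (½^ suc i ℚ.* (½ ℚ.* δ)) (ErrorAt i)
      small-errorAt i with em-0 {∃[ j ] toℕ {n} j ≡ i}
      ... | no none = small-∅ (ℚ.<⇒≤ (scale-positive (suc i) (half-positive δ>0))) λ (j , eq , _) → none (j , eq)
      ... | yes (j , refl) = small-⊆ (λ { {y} (k , eq , y∈) →
                subst (λ k → y ∈ Error k) (Fin.toℕ-injective eq) y∈ })
              ℚ.≤-refl (small-translates F± (error>0 j) (proj₂ (approx j)))

      split : ∀ {y} → y ∈ᶜ ∁ᶜ good → (¬ FreeSequence y) ⊎ (∃[ i ] y ∈ ErrorAt i)
      split {y} y∉good with em-g {FreeSequence y}
      ... | no ¬free = inj₁ ¬free
      ... | yes free with covering (config y , free)
      ...   | j , y∈I = inj₂ (toℕ j , j , refl ,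
              uncovered⇒error (λ {x} {x′} → independent j {x} {x′}) (C j) free y∈I
                λ y∈core → ∈-∁ᶜ⁻ good {y} y∉good (∈-⋃ᶠ⁺ (core ∘ C) j y y∈core))

      bad-small : Small δ (_∈ᶜ ∁ᶜ good)
      bad-small = small-⊆ (λ {y} → split {y}) (ℚ.≤-reflexive (half+half δ))
        (small-∪ (small-nonfree infinite (half-positive δ>0))
          (small-⋃ {A = ErrorAt} (ℚ.<⇒≤ (half-positive δ>0)) small-errorAt))

  module Labelling (w : ℕ) where

    colors : Coloring (λ γ → ∃[ i ] i ℕ.< w × (∃[ j ] j ℕ.< w × Quotient i j γ))
    colors = windowColoring w

    depth : ℕ
    depth = bound colors ℕ.+ w

    -- Indices that code no group element get colors of their own.
    slot : Point → ℕ → ℕ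
    slot x i with em-g {Coded i}
    ... | yes (γ , _) = color colors (γ · x)
    ... | no _        = bound colors ℕ.+ i

    slot-code : ∀ x γ → slot x (code γ) ≡ color colors (γ · x)
    slot-code x γ with em-g {Coded (code γ)}
    ... | yes (γ′ , eq) = color-cong colors {γ′ · x} {γ · x} (·-cong {x = x} {x} (code-injective eq) (reflᶠ {x}))
    ... | no uncoded    = contradiction (γ , refl) uncoded

    -- This is the equivariance of `label h`. At the code of `γ` both sides are the color of
    -- `(γ ∙ σ) · x`; a dummy index is fixed by `translate σ` and its slot is the same for all
    -- points.
    slot-translate : ∀ σ {x y} → y ≈ᶠ σ · x → ∀ i → slot y i ≡ slot x (translate σ i)
    slot-translate σ {x} {y} y≈σx i with em-g {Coded i}
    ... | yes (γ , _) = trans (color-cong colors {γ · y} {(γ ∙ σ) · x} γy≈γσx) (sym (slot-code x (γ ∙ σ)))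
      where
      γy≈γσx : γ · y ≈ᶠ (γ ∙ σ) · x
      γy≈γσx = transᶠ {γ · y} {γ · σ · x} {(γ ∙ σ) · x} (·-cong {x = y} {σ · x} reflᴳ y≈σx)
        (symᶠ {(γ ∙ σ) · x} {γ · σ · x} (·-assoc γ σ x))
    ... | no uncoded with em-g {Coded i}
    ...   | yes coded = contradiction coded uncoded
    ...   | no _      = refl

    slot<depth : ∀ x {i} → i ℕ.< w → slot x i ℕ.< depth
    slot<depth x {i} i<w with em-g {Coded i}
    ... | yes (γ , _) = ℕ.<-≤-trans (color<bound colors (γ · x)) (ℕ.m≤m+n (bound colors) w)
    ... | no _        = ℕ.+-monoʳ-< (bound colors) i<w

    slot-injective : ∀ x {i j} → i ℕ.< w → j ℕ.< w → slot x i ≡ slot x j → i ≡ j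
    slot-injective x {i} {j} i<w j<w eq with em-g {Coded i} | em-g {Coded j}
    ... | no _ | no _ = ℕ.+-cancelˡ-≡ (bound colors) i j eq
    ... | yes (γ , _) | no _ = contradiction eq
          (ℕ.<⇒≢ (ℕ.<-≤-trans (color<bound colors (γ · x)) (ℕ.m≤m+n (bound colors) j)))
    ... | no _ | yes (γ , _) = contradiction (sym eq)
          (ℕ.<⇒≢ (ℕ.<-≤-trans (color<bound colors (γ · x)) (ℕ.m≤m+n (bound colors) i)))
    ... | yes (γ , refl) | yes (δ , refl) = code-cong (transᴳ (symᴳ quotient∙δ)
          (transᴳ (∙-congʳ trivial) (identityˡ δ)))
      where
      quotient∙δ : (γ ∙ δ ⁻¹) ∙ δ ≈ᴳ γ
      quotient∙δ = transᴳ (assoc γ (δ ⁻¹) δ) (transᴳ (∙-congˡ (inverseˡ δ)) (identityʳ γ))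
      γx≈ : γ · x ≈ᶠ (γ ∙ δ ⁻¹) · δ · x
      γx≈ = transᶠ {γ · x} {((γ ∙ δ ⁻¹) ∙ δ) · x} {(γ ∙ δ ⁻¹) · δ · x}
        (·-cong {x = x} {x} (symᴳ quotient∙δ) (reflᶠ {x})) (·-assoc (γ ∙ δ ⁻¹) δ x)
      trivial : γ ∙ δ ⁻¹ ≈ᴳ ε
      trivial = separates colors (_ , i<w , _ , j<w , γ , δ , refl , refl , reflᴳ) (δ · x)
        (trans (sym eq) (color-cong colors {γ · x} {(γ ∙ δ ⁻¹) · δ · x} γx≈))

    label : Sequence → Point → Sequence
    label h x = h ∘ slot x

    label-borel : ∀ h i → BorelFree (λ x → Lift g (label h x i ≡ true))
    label-borel h i with em-g {Coded i}
    ... | yes (γ , _) = borel-preimage (borelMap-shift γ (color-borel colors)) λ c → Lift g (h c ≡ true)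
    ... | no _        = borel-const _

    -- Splitting on the first bit yields a finite Boolean combination of Borel sets. The map `f` is
    -- arbitrary so that the induction can pass to its tail.
    local-borel : ∀ m {φ} → Local m φ → (f : Point → Sequence) →
      (∀ i → BorelFree (λ x → Lift g (f x i ≡ true))) → BorelFree (λ x → Lift g (φ (f x) ≡ true))
    local-borel zero {φ} loc f borel = resp
      ( (λ { {x} (lift eq) → lift (trans (loc (f x) (λ _ → false) λ _ ()) eq) })
      , (λ { {x} (lift eq) → lift (trans (loc (λ _ → false) (f x) λ _ ()) eq) }) )
      (borel-const (Lift g (φ (λ _ → false) ≡ true)))
    local-borel (suc m) {φ} loc f borel = resp ((λ {x} → to {x}) , λ {x} → from {x})
      (borel-∪ (borel-∩ (borel 0) (tail true)) (borel-∩ (complement (borel 0)) (tail false)))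
      where
      Tail : Bool → Pred Point g
      Tail b x = Lift g (φ (b ◂ f x ∘ suc) ≡ true)
      Head : Pred Point g
      Head x = Lift g (f x 0 ≡ true)
      tail : ∀ b → BorelFree (Tail b)
      tail b = local-borel m (local-◂ b loc) (λ x → f x ∘ suc) (borel ∘ suc)
      unfold : ∀ x b → f x 0 ≡ b → φ (f x) ≡ φ (b ◂ f x ∘ suc)
      unfold x b eq = loc _ _ λ { zero _ → eq ; (suc i) _ → refl }
      to : (Head ∩ Tail true) ∪ (∁ Head ∩ Tail false) ⊆ λ x → Lift g (φ (f x) ≡ true)
      to {x} (inj₁ (lift eq , lift t))  = lift (trans (unfold x true eq) t)
      to {x} (inj₂ (¬eq , lift t))      = lift (trans (unfold x false (Bool.¬-not (¬eq ∘ lift))) t)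
      from : (λ x → Lift g (φ (f x) ≡ true)) ⊆ (Head ∩ Tail true) ∪ (∁ Head ∩ Tail false)
      from {x} (lift t) with f x 0 in eq
      ... | true  = inj₁ (lift refl , lift (trans (sym (unfold x true eq)) t))
      ... | false = inj₂ ((λ ()) , lift (trans (sym (unfold x false eq)) t))

    Labelled : Clopen → Sequence → Pred Point g
    Labelled C h x = Lift g (label h x ∈ᶜ C)

    labelled-borel : ∀ C h → BorelFree (Labelled C h)
    labelled-borel C h = local-borel (size C) (local C) (label h) (label-borel h)

    -- By equivariance the label of `y` is the translate by `σ` of the label of `x`. If the former
    -- lies in `C`, the latter lies in `moved F± C` and was deleted.
    labelled-independent : ∀ C h → Independent (Labelled (core C) h)
    labelled-independent C h {x} {y} (lift x∈) (lift y∈) (x≉y , σ , σ∈ , y≈σx) =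
      ∈-∁ᶜ⁻ (moved F± C) {label h x} (proj₂ (∈-∩ᶜ⁻ C (∁ᶜ (moved F± C)) {label h x} x∈))
        (∈-moved⁺ F± C (label h x) σ≉ε σ∈
          (∈ᶜ-resp C (λ i → cong h (slot-translate σ {x} {y} y≈σx i))
            (proj₁ (∈-∩ᶜ⁻ C (∁ᶜ (moved F± C)) {label h y} y∈))))
      where
      σ≉ε : σ ≉ᴳ ε
      σ≉ε σ≈ε = x≉y (transᶠ {x} {ε · x} {y} (symᶠ {ε · x} {x} (·-id x))
        (transᶠ {ε · x} {σ · x} {y} (·-cong {x = x} {x} (symᴳ σ≈ε) (reflᶠ {x})) (symᶠ {y} {σ · x} y≈σx)))

    -- A labelling of the colors by independent fair bits makes the bits
    -- label h x i, i < w, independent and fair for every single point x.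
    labelled-count : ∀ C → size C ≡ w → ∀ x →
      count depth (λ h → contains C (label h x)) ≡ count depth (contains C)
    labelled-count C refl x = fromℕ-injective (trans (sym (μ-count depth (λ h → contains C (label h x))))
      (trans (cong (ℚ._* fromℕ (2 ℕ.^ depth)) same) (μ-count depth (contains C))))
      where
      same : μ depth (λ h → contains C (label h x)) ≡ μ depth (contains C)
      same = trans (μ-reindex (slot x) (local C) (slot<depth x) (slot-injective x))
        (measure-μ C (ℕ.m≤n+m w (bound colors)))

  clopen⇒kFoldCover : ∀ {n} (C : Fin n → Clopen) →
    let good = ⋃ᶠ (core ∘ C) in
    ∃[ d ] size good ℕ.≤ d × HasKFoldCover (count d (contains good)) (familySize {n} d)
  clopen⇒kFoldCover {n} C = depth , ℕ.m≤n+m (size good) (bound colors) ,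
    family depth sets ,
    family-all BorelFree depth sets (λ h j → labelled-borel (core (C j)) h) ,
    family-all Independent depth sets (λ h j {x} {y} → labelled-independent (C j) h {x} {y}) ,
    λ x → let J , ≤J , J⊆ = family-select x depth sets (λ h → contains good (label h x)) (λ h → in-some x h) in
      J , subst (ℕ._≤ ∣ J ∣) (labelled-count good refl x) ≤J , J⊆
    where
    good : Clopen
    good = ⋃ᶠ (core ∘ C)
    open Labelling (size good)
    sets : Sequence → Fin n → Pred Point g
    sets h j = Labelled (core (C j)) h
    in-some : ∀ x h → contains good (label h x) ≡ true → ∃[ j ] x ∈ sets h j
    in-some x h eq = let j , y∈ = ∈-⋃ᶠ⁻ (core ∘ C) (label h x) eq in j , lift y∈

  kFoldCover⇒above : ∀ {k n q} → HasKFoldCover (suc k) n → + n / suc k ℚ.< q → q ∈ above fractionalχᴮ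
  kFoldCover⇒above {k} {n} {q} cover n/k<q with least-≤ em (HasKFoldCover (suc k)) cover
  ... | m , eq , m≤n = k , subst (λ χ → q ∈ above (χ ÷ suc k)) (sym eq)
        (ℚ.≤-<-trans (fromℚᵘ-mono-≤ {mkℚᵘ (+ m) k} {mkℚᵘ (+ n) k}
          (ℚᵘ.*≤* (ℤ.*-monoʳ-≤-nonNeg (+ suc k) (ℤ.+≤+ m≤n)))) n/k<q)

  infinite-case : Infinite → ∀ {n} → HasMeasurableCover βFree n → fractionalχᴮ ≤ᴿ fromℕ⁺ [ n ]
  infinite-case infinite {n} (I , measurable , independent , covering) {q} n<q = finish k refl
    where
    n≥0 : 0ℚ ℚ.≤ fromℕ n
    n≥0 = subst (ℚ._≤ fromℕ n) fromℕ-0 (fromℕ-mono-≤ {0} {n} z≤n)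
    tol : ∃[ δ ] 0ℚ ℚ.< δ × (∀ {m} → 1ℚ ℚ.≤ m ℚ.+ δ → fromℕ n ℚ.< m ℚ.* q)
    tol = exists-tolerance n≥0 (subst (ℚ._< q) (sym (fromℕ-/ n)) n<q)
    approximants : Σ[ C ∈ (Fin n → Clopen) ] 1ℚ ℚ.≤ measure (⋃ᶠ (core ∘ C)) ℚ.+ proj₁ tol
    approximants = clopenCover infinite I measurable independent covering (proj₁ (proj₂ tol))
    C : Fin n → Clopen
    C = proj₁ approximants
    good : Clopen
    good = ⋃ᶠ (core ∘ C)
    kFold : ∃[ d ] size good ℕ.≤ d × HasKFoldCover (count d (contains good)) (familySize {n} d)
    kFold = clopen⇒kFoldCover C
    d k : ℕ
    d = proj₁ kFold
    k = count d (contains good)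

    -- There are n · 2^d sets and the multiplicity is `k` = `measure good` · 2^d, so the ratio is n
    -- / `measure good`, which the tolerance keeps below `q`.
    enough : fromℕ n ℚ.* fromℕ (2 ℕ.^ d) ℚ.< fromℕ k ℚ.* q
    enough = begin-strict
      fromℕ n ℚ.* fromℕ (2 ℕ.^ d)
        <⟨ ℚ.*-monoˡ-<-pos (fromℕ (2 ℕ.^ d)) {{ℚ.positive (fromℕ-positive (2 ℕ.^ d) {{ℕ.m^n≢0 2 d}})}}
            (proj₂ (proj₂ tol) {measure good} (proj₂ approximants)) ⟩
      measure good ℚ.* q ℚ.* fromℕ (2 ℕ.^ d)
        ≡⟨ trans (ℚ.*-assoc (measure good) q _) (trans (cong (measure good ℚ.*_) (ℚ.*-comm q _))
            (sym (ℚ.*-assoc (measure good) _ q))) ⟩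
      measure good ℚ.* fromℕ (2 ℕ.^ d) ℚ.* q
        ≡⟨ cong (ℚ._* q) (trans (cong (ℚ._* fromℕ (2 ℕ.^ d)) (measure-μ good (proj₁ (proj₂ kFold))))
            (μ-count d (contains good))) ⟩
      fromℕ k ℚ.* q ∎
      where open ℚ.≤-Reasoning

    -- The infimum runs over positive multiplicities. `k ≡ 0` contradicts `enough`, whose left side
    -- is nonnegative.
    finish : ∀ k′ → k ≡ k′ → q ∈ above fractionalχᴮ
    finish zero eq = ⊥-elim (ℚ.<-irrefl refl (begin-strict
      0ℚ                               ≡⟨ ℚ.*-zeroˡ (fromℕ (2 ℕ.^ d)) ⟨
      0ℚ ℚ.* fromℕ (2 ℕ.^ d)           ≤⟨ *-monoʳ-≤ (ℚ.<⇒≤ (fromℕ-positive (2 ℕ.^ d) {{ℕ.m^n≢0 2 d}})) n≥0 ⟩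
      fromℕ n ℚ.* fromℕ (2 ℕ.^ d)      <⟨ enough ⟩
      fromℕ k ℚ.* q                    ≡⟨ cong (λ k → fromℕ k ℚ.* q) eq ⟩
      fromℕ 0 ℚ.* q                    ≡⟨ cong (ℚ._* q) fromℕ-0 ⟩
      0ℚ ℚ.* q                         ≡⟨ ℚ.*-zeroˡ q ⟩
      0ℚ                               ∎))
      where open ℚ.≤-Reasoning
    finish (suc k′) eq = kFoldCover⇒above
      (subst (λ k → HasKFoldCover k (familySize {n} d)) eq (proj₂ (proj₂ kFold)))
      (÷-< {n = n} {2 ℕ.^ d} ℕ.≤-refl (familySize≡ {n} d)
        (subst (λ k → fromℕ n ℚ.* fromℕ (2 ℕ.^ d) ℚ.< fromℕ k ℚ.* q) eq enough))

  finite-case : ∀ {b} → (∀ γ → code γ ℕ.< b) → ∀ {n} → HasMeasurableCover βFree n →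
    fractionalχᴮ ≤ᴿ fromℕ⁺ [ n ]
  finite-case bounded {n} (I , measurable , independent , covering) n<q = kFoldCover⇒above
    (I , (λ j → measurable⇒borel (measurable j)) , independent , λ x → let j , x∈ = covering x in
      ⁅ j ⁆ , ℕ.≤-reflexive (sym (Subset.∣⁅x⁆∣≡1 j)) ,
      λ i∈ → subst (λ i → x ∈ I i) (sym (Subset.x∈⁅y⁆⇒x≡y j i∈)) x∈)
    n<q
    where
    measurable⇒borel : ∀ {A} → Measurable βFree A → BorelFree A
    measurable⇒borel (_ , B , borelB , M , _ , (null , _) , Δ⊆M) = resp
      ( (λ x∈B → decidable-stable em-g λ x∉A → null⇒empty bounded {M} null (Δ⊆M (inj₂ (x∈B , x∉A))))
      , (λ x∈A → decidable-stable em-g λ x∉B → null⇒empty bounded {M} null (Δ⊆M (inj₁ (x∈A , x∉B)))) )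
      borelB

  bound-by-least : ∀ χ → IsLeast (HasMeasurableCover βFree) χ → fractionalχᴮ ≤ᴿ fromℕ⁺ χ
  bound-by-least ⊤⁺ _ = λ ()
  bound-by-least [ n ] (cover , _) with em-g {Infinite}
  ... | yes infinite = infinite-case infinite cover
  ... | no ¬infinite = finite-case bounded cover
    where
    finite : ∃[ b ] ¬ (∃[ γ ] b ℕ.≤ code γ)
    finite = decidable-stable em-g λ none → ¬infinite λ b → decidable-stable em-g λ ¬γ → none (b , ¬γ)
    bounded : ∀ γ → code γ ℕ.< proj₁ finite
    bounded γ = ℕ.≰⇒> λ b≤γ → proj₂ finite (γ , b≤γ)

corollary1p2 : ∀ {g} (em : ExcludedMiddle (lsuc g)) (Γ : Group g g) →
    Countable (Group.setoid Γ) →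
    (F : List (Group.Carrier Γ)) →
    let open Bernoulli Γ
        G = schreier (freeAction shift) F
        open Chromatic em G BorelFree
    in fractionalχᴮ ≤ᴿ fromℕ⁺ (measurableχ βFree)
corollary1p2 em Γ countable F = bound-by-least _ (proj₂ (leastWithProof em (HasMeasurableCover βFree)))
  where
  open Bernoulli Γ
  open Chromatic em (schreier (freeAction shift) F) BorelFree
  open Covers em Γ countable F
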